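{- Let ${\bold H}$ be a function with domain $\omega$ such that each ${\bold H}(i)$ is a countable set with at least two elements, and let $(K,\Sigma,\Sigma^\bot)$ be a semi--creating triple for ${\bold H}$ which is linked, semi--gluing and has the cutting property. Then the forcing notion $\mathbb{Q}^+_\infty(K,\Sigma,\Sigma^\bot)$ is $\sigma$-$*$--linked.
   Context: A semi--creature for ${\bold H}$ is a quadruple $t=(\mathbf{dom}[t],\mathbf{sval}[t],\mathbf{nor}[t],\mathbf{dis}[t])$ with $\mathbf{dom}[t]$ a non-empty finite subset of $\omega$, $\emptyset\neq\mathbf{sval}[t]\subseteq\prod_{i\in\mathbf{dom}[t]}{\bold H}(i)$, $\mathbf{nor}[t]\in[0,\infty)\cup\{\infty\}$, $\mathbf{dis}[t]$ hereditarily countable, and $\mathbf{sval}[t]=\prod_{i\in\mathbf{dom}[t]}{\bold H}(i)$ iff $\mathbf{nor}[t]=\infty$. A semi--composition operation $\Sigma$ on a set $K$ of semi--creatures maps finite subsets of $K$ to subsets of $K$ with: (a) if $s\in\Sigma(\mathcal S_s)$ for all $s\in\mathcal S$ then $\Sigma(\mathcal S)\subseteq\Sigma(\bigcup_s\mathcal S_s)$; (b) $t\in\Sigma(\{t\})$, $\Sigma(\emptyset)=\emptyset$; (c) if $t\in\Sigma(\mathcal S)$ then $\mathbf{dom}[t]=\bigcup_{s\in\mathcal S}\mathbf{dom}[s]$, $v\restriction\mathbf{dom}[s]\in\mathbf{sval}[s]$ for $v\in\mathbf{sval}[t]$, $s\in\mathcal S$, and distinct members of $\mathcal S$ have disjoint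 domains. A semi--decomposition operation $\Sigma^\bot$ assigns to each $t\in K$ a non-empty family of finite subsets of $K$ with: (a) if $\{s_0,\dots,s_k\}\in\Sigma^\bot(t)$ and $\mathcal S_i\in\Sigma^\bot(s_i)$ then $\bigcup_i\mathcal S_i\in\Sigma^\bot(t)$; (b) $\{t\}\in\Sigma^\bot(t)$; (c) if $\mathcal S\in\Sigma^\bot(t)$ then $\mathbf{dom}[t]=\bigcup_{s\in\mathcal S}\mathbf{dom}[s]$ and each $v\in\prod_{i\in\mathbf{dom}[t]}{\bold H}(i)$ with $v\restriction\mathbf{dom}[s]\in\mathbf{sval}[s]$ for all $s\in\mathcal S$ is in $\mathbf{sval}[t]$. $(K,\Sigma,\Sigma^\bot)$ is then a semi--creating triple. Conditions of $\mathbb{Q}^+_\infty(K,\Sigma,\Sigma^\bot)$ are sequences $p=(w^p,t^p_0,t^p_1,\dots)$ with $w^p$ a finite function, $w^p(i)\in{\bold H}(i)$, $t^p_i\in K$, $\mathrm{dom}(w^p)$ and the $\mathbf{dom}[t^p_i]$ partitioning $\omega$, $\mathbf{nor}[t^p_i]\neq\infty$ for all $i$ and $\lim_i\mathbf{nor}[t^p_i]=\infty$. $p\leq q$ ($q$ stronger) iff $q$ arises from $p$ by finitely many operations: deciding the value (for a finite $A\subseteq\omega$, extend $w$ to $w^*$ with domain $\mathrm{dom}(w)\cup\bigcup_{i\in A}\mathbf{dom}[t_i]$, $w^*\restriction\mathbf{dom}[t_i]\in\mathbf{sval}[t_i]$ for $i\in A$, and keep exactly the $t_i$, $i\notin A$);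 applying $\Sigma$ (replace the sequence by $t^*_i\in\Sigma(\{t_j:j\in A_i\})$ for pairwise disjoint finite $A_i\subseteq\omega$); applying $\Sigma^\bot$ (new sequence $t^*_j$ with pairwise disjoint non-empty finite $A_i$ and $\{t^*_j:j\in A_i\}\in\Sigma^\bot(t_i)$); results of operations must be conditions. The triple is linked if for all $t_0,t_1\in K$ with $\mathbf{nor}[t_0],\mathbf{nor}[t_1]>1$ and $\mathbf{dom}[t_0]=\mathbf{dom}[t_1]$ there is $s\in\Sigma(\{t_0\})\cap\Sigma(\{t_1\})$ with $\mathbf{nor}[s]\geq\min\{\mathbf{nor}[t_0],\mathbf{nor}[t_1]\}-1$. It is semi--gluing if for all $t_0,\dots,t_n\in K$ with pairwise disjoint domains there is $s\in\Sigma(\{t_0,\dots,t_n\})$ with $\mathbf{nor}[s]\geq\min_k\mathbf{nor}[t_k]-1$. It has the cutting property if for every $t\in K$ with $\mathbf{nor}[t]>1$ and every non-empty proper subset $z$ of $\mathbf{dom}[t]$ there are $s_0,s_1\in K$ with $\mathbf{dom}[s_0]=z$, $\mathbf{dom}[s_1]=\mathbf{dom}[t]\setminus z$, $\mathbf{nor}[s_\ell]\geq\mathbf{nor}[t]-1$ ($\ell=0,1$) and $\{s_0,s_1\}\in\Sigma^\bot(t)$. A forcing notion $\mathbb{Q}$ is $\sigma$-$*$--linked if for every $n\in\omega$ there is a partition $\langle A_i:i\in\omega\rangle$ of $\mathbb{Q}$ such that any $q_0,\dots,q_n$ lying in one $A_i$ have a common upper bound in $\mathbb{Q}$. -}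

module Defs where

open import Level using (Level; 0ℓ; _⊔_) renaming (suc to lsuc)
open import Data.Fin.Base using (Fin)
open import Data.List.Base using (List; []; _∷_; [_]; _++_; map; concatMap)
open import Data.List.NonEmpty.Base as List⁺ using (List⁺)
open import Data.List.Membership.Propositional using (_∈_; _∉_)
open import Data.List.Relation.Binary.BagAndSetEquality using (_∼[_]_; set)
open import Data.List.Relation.Binary.Disjoint.Propositional using (Disjoint)
open import Data.List.Relation.Binary.Subset.Propositional using (_⊆_)
import Data.List.Relation.Binary.Subset.Setoid as SetoidSubset
open import Data.List.Relation.Unary.All using (All)
open import Data.List.Relation.Unary.All.Properties using (anti-mono)
open import Data.List.Relation.Unary.AllPairs using (AllPairs)
open import Data.List.Relation.Unary.Any using (here)
open import Data.Maybe.Base as Maybe using ()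
open import Data.Nat.Base as ℕ using (ℕ)
open import Data.Product.Base using (∃; _×_; _,_; proj₁; proj₂)
open import Data.Rational.Base as ℚ using (ℚ; 0ℚ; 1ℚ)
import Data.Rational.Properties as ℚ
open import Data.Sum.Base using (_⊎_; inj₁; inj₂)
open import Function.Base using (_∘_; id)
open import Function.Bundles using (_⇔_)
open import Function.Properties.Equivalence using (⇔-isEquivalence)
open import Relation.Binary.Bundles using (Preorder; Setoid)
open import Relation.Binary.Core using (Rel)
open import Relation.Binary.Construct.Closure.ReflexiveTransitive using (Star; ε; _◅_; _◅◅_)
import Relation.Binary.Construct.Add.Supremum.NonStrict as AddSupremum≤
import Relation.Binary.Construct.Add.Supremum.Strict as AddSupremum<
import Relation.Binary.Construct.On as On
open import Relation.Binary.Definitions using (tri<; tri≈; tri>)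
open import Relation.Binary.Structures using (IsEquivalence; IsPreorder)
open import Relation.Binary.PropositionalEquality.Core
  using (_≡_; _≢_; refl; sym; trans; cong; subst)
open import Relation.Nullary.Construct.Add.Supremum using (_⁺) renaming ([_] to fin; ⊤⁺ to ∞)
open import Relation.Nullary.Negation.Core using (¬_; contradiction)
import Relation.Unary as U
open U using (Pred)

------------------------------------------------------------------------
-- Real numbers, as Dedekind cuts.  A real is given by its lower cut
-- alone, and x < y, x ≤ y compare lower cuts; these are the usual reals
-- and orders in the presence of excluded middle.

record ℝ : Set₁ where
  field
    cut       : Pred ℚ 0ℓ
    inhabited : ∃ λ q → q U.∈ cut
    bounded   : ∃ λ q → q U.∉ cut
    lower     : ∀ {p q} → p ℚ.< q → q U.∈ cut → p U.∈ cut
    open′     : ∀ {q} → q U.∈ cut → ∃ λ r → q ℚ.< r × r U.∈ cut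

open ℝ

infix 4 _≤_ _<_

_≤_ : Rel ℝ 0ℓ
x ≤ y = cut x U.⊆ cut y

_<_ : Rel ℝ 0ℓ
x < y = ∃ λ q → q U.∉ cut x × q U.∈ cut y

fromℚ : ℚ → ℝ
fromℚ p = record
  { cut       = ℚ._< p
  ; inhabited = p ℚ.- 1ℚ , subst (p ℚ.- 1ℚ ℚ.<_) (ℚ.+-identityʳ p)
                             (ℚ.+-monoʳ-< p (ℚ.negative⁻¹ (ℚ.- 1ℚ)))
  ; bounded   = p , ℚ.<-irrefl refl
  ; lower     = ℚ.<-trans
  ; open′     = ℚ.<-dense
  }

_⊓_ : ℝ → ℝ → ℝ
x ⊓ y = record
  { cut       = λ q → q U.∈ cut x × q U.∈ cut y
  ; inhabited = meet (inhabited x) (inhabited y)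
  ; bounded   = let q , q∉x = bounded x in q , q∉x ∘ proj₁
  ; lower     = λ p<q (q∈x , q∈y) → lower x p<q q∈x , lower y p<q q∈y
  ; open′     = λ {q} (q∈x , q∈y) →
      let r , q<r , r∈x = open′ x q∈x
          s , q<s , s∈y = open′ y q∈y
      in r ℚ.⊓ s , below q<r q<s , lowers r∈x s∈y
  }
  where
  lowers : ∀ {r s} → r U.∈ cut x → s U.∈ cut y → r ℚ.⊓ s U.∈ cut x × r ℚ.⊓ s U.∈ cut y
  lowers {r} {s} r∈x s∈y = lower≤ x (ℚ.p⊓q≤p r s) r∈x , lower≤ y (ℚ.p⊓q≤q r s) s∈y
    where
    lower≤ : ∀ z {p q} → p ℚ.≤ q → q U.∈ cut z → p U.∈ cut z
    lower≤ z {p} {q} p≤q q∈z with ℚ.<-cmp p q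
    ... | tri< p<q _ _ = lower z p<q q∈z
    ... | tri≈ _ p≡q _ = subst (cut z) (sym p≡q) q∈z
    ... | tri> _ _ q<p = contradiction (ℚ.<-≤-trans q<p p≤q) (ℚ.<-irrefl refl)
  meet : ∃ (cut x) → ∃ (cut y) → ∃ λ q → q U.∈ cut x × q U.∈ cut y
  meet (r , r∈x) (s , s∈y) = r ℚ.⊓ s , lowers r∈x s∈y
  below : ∀ {q r s} → q ℚ.< r → q ℚ.< s → q ℚ.< r ℚ.⊓ s
  below {q} {r} {s} q<r q<s with ℚ.⊓-sel r s
  ... | inj₁ eq = subst (q ℚ.<_) (sym eq) q<r
  ... | inj₂ eq = subst (q ℚ.<_) (sym eq) q<s

_-ℚ_ : ℝ → ℚ → ℝ
x -ℚ r = record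
  { cut       = λ q → q ℚ.+ r U.∈ cut x
  ; inhabited = let q , q∈x = inhabited x in q ℚ.- r , subst (cut x) (sym (cancel q)) q∈x
  ; bounded   = let q , q∉x = bounded x in q ℚ.- r , q∉x ∘ subst (cut x) (cancel q)
  ; lower     = λ p<q → lower x (ℚ.+-monoˡ-< r p<q)
  ; open′     = λ {q} q+r∈x →
      let s , q+r<s , s∈x = open′ x q+r∈x
      in s ℚ.- r
       , subst (ℚ._< s ℚ.- r) (cancel′ q) (ℚ.+-monoˡ-< (ℚ.- r) q+r<s)
       , subst (cut x) (sym (cancel s)) s∈x
  }
  where
  cancel : ∀ q → (q ℚ.- r) ℚ.+ r ≡ q
  cancel q = trans (ℚ.+-assoc q (ℚ.- r) r)
            (trans (cong (q ℚ.+_) (ℚ.+-inverseˡ r)) (ℚ.+-identityʳ q))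
  cancel′ : ∀ q → (q ℚ.+ r) ℚ.- r ≡ q
  cancel′ q = trans (ℚ.+-assoc q r (ℚ.- r))
             (trans (cong (q ℚ.+_) (ℚ.+-inverseʳ r)) (ℚ.+-identityʳ q))

ℝ∞ : Set₁
ℝ∞ = ℝ ⁺

open AddSupremum≤ _≤_ public using (_≤⁺_; _≤⊤⁺) renaming ([_] to fin≤)
open AddSupremum< _<_ public using (_<⁺_; [_]<⊤⁺) renaming ([_] to fin<)

infixl 6 _−1
infixl 7 _⊓⁺_

_⊓⁺_ : ℝ∞ → ℝ∞ → ℝ∞
fin x ⊓⁺ fin y = fin (x ⊓ y)
fin x ⊓⁺ ∞     = fin x
∞     ⊓⁺ y     = y

_−1 : ℝ∞ → ℝ∞
_−1 = Maybe.map (_-ℚ 1ℚ)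

------------------------------------------------------------------------
-- Hereditarily countable sets: a set is either empty or enumerated
-- (possibly with repetitions) by ω.

data HC : Set where
  empty : HC
  enum  : (ℕ → HC) → HC

infix 4 _≈ᴴ_

data _≈ᴴ_ : Rel HC 0ℓ where
  empty : empty ≈ᴴ empty
  enum  : ∀ {f g} → (∀ m → ∃ λ n → f m ≈ᴴ g n) → (∀ n → ∃ λ m → f m ≈ᴴ g n) →
          enum f ≈ᴴ enum g

≈ᴴ-refl : ∀ {x} → x ≈ᴴ x
≈ᴴ-refl {empty}  = empty
≈ᴴ-refl {enum f} = enum (λ m → m , ≈ᴴ-refl) (λ n → n , ≈ᴴ-refl)

≈ᴴ-sym : ∀ {x y} → x ≈ᴴ y → y ≈ᴴ x
≈ᴴ-sym empty      = empty
≈ᴴ-sym (enum p q) = enum (λ n → let m , e = q n in m , ≈ᴴ-sym e)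
                         (λ m → let n , e = p m in n , ≈ᴴ-sym e)

≈ᴴ-trans : ∀ {x y z} → x ≈ᴴ y → y ≈ᴴ z → x ≈ᴴ z
≈ᴴ-trans empty      empty        = empty
≈ᴴ-trans (enum p q) (enum p′ q′) = enum
  (λ m → let n , e = p m ; k , e′ = p′ n in k , ≈ᴴ-trans e e′)
  (λ k → let n , e′ = q′ k ; m , e = q n in m , ≈ᴴ-trans e e′)

------------------------------------------------------------------------
-- Semi-creatures.  A finite subset of ω is a strictly increasing list,
-- so two of them are equal as sets iff they are equal as lists, and
-- All H d is the product of the H i over i ∈ d.

infix 5 _↾_

-- Entries of d are distinct when d is strictly increasing, so v ↾ sub
-- does not depend on the choice of the proof sub.
_↾_ : {H : ℕ → Set} {d e : List ℕ} → All H e → d ⊆ e → All H d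
v ↾ sub = anti-mono sub v

record SemiCreature (H : ℕ → Set) : Set₁ where
  field
    dom          : List ℕ
    dom-sorted   : AllPairs ℕ._<_ dom
    dom-nonempty : dom ≢ []
    sval         : Pred (All H dom) 0ℓ
    sval-nonempty : ∃ sval
    nor          : ℝ∞
    nor-nonneg   : fin (fromℚ 0ℚ) ≤⁺ nor
    dis          : HC
    full⇔∞       : (∀ v → v U.∈ sval) ⇔ (nor ≡ ∞)

-- Equality of quadruples, componentwise and extensional.
record SameCreature {H : ℕ → Set} (s t : SemiCreature H) : Set₁ where
  private
    module s = SemiCreature s
    module t = SemiCreature t
  field
    dom-≡  : s.dom ≡ t.dom
    sval-⇔ : ∀ v → v U.∈ s.sval ⇔ subst (All H) dom-≡ v U.∈ t.sval
    nor-≤  : s.nor ≤⁺ t.nor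
    nor-≥  : t.nor ≤⁺ s.nor
    dis-≈  : s.dis ≈ᴴ t.dis

semiCreatureSetoid : (H : ℕ → Set) → Setoid (lsuc 0ℓ) (lsuc 0ℓ)
semiCreatureSetoid H = record
  { Carrier       = SemiCreature H
  ; _≈_           = SameCreature
  ; isEquivalence = record { refl = rfl ; sym = symm ; trans = tran }
  }
  where
  open SameCreature
  module ⇔ = IsEquivalence (⇔-isEquivalence {0ℓ})

  ≤⁺-trans : ∀ {x y z} → x ≤⁺ y → y ≤⁺ z → x ≤⁺ z
  ≤⁺-trans = AddSupremum≤.≤⁺-trans _≤_ (λ p q → q ∘ p)

  ≤⁺-refl : ∀ {x} → x ≤⁺ x
  ≤⁺-refl {fin x} = fin≤ id
  ≤⁺-refl {∞}     = ∞ ≤⊤⁺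

  rfl : ∀ {s} → SameCreature s s
  rfl = record
    { dom-≡ = refl ; sval-⇔ = λ _ → ⇔.refl ; nor-≤ = ≤⁺-refl ; nor-≥ = ≤⁺-refl
    ; dis-≈ = ≈ᴴ-refl }

  sval-sym : ∀ {d e} (eq : d ≡ e) {P : Pred (All H d) 0ℓ} {Q : Pred (All H e) 0ℓ} →
             (∀ v → P v ⇔ Q (subst (All H) eq v)) → ∀ v → Q v ⇔ P (subst (All H) (sym eq) v)
  sval-sym refl h v = ⇔.sym (h v)

  sval-trans : ∀ {c d e} (eq : c ≡ d) (eq′ : d ≡ e)
               {P : Pred (All H c) 0ℓ} {Q : Pred (All H d) 0ℓ} {R : Pred (All H e) 0ℓ} →
               (∀ v → P v ⇔ Q (subst (All H) eq v)) → (∀ v → Q v ⇔ R (subst (All H) eq′ v)) →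
               ∀ v → P v ⇔ R (subst (All H) (trans eq eq′) v)
  sval-trans refl refl h h′ v = ⇔.trans (h v) (h′ v)

  symm : ∀ {s t} → SameCreature s t → SameCreature t s
  symm e = record
    { dom-≡ = sym (dom-≡ e) ; sval-⇔ = sval-sym (dom-≡ e) (sval-⇔ e)
    ; nor-≤ = nor-≥ e ; nor-≥ = nor-≤ e ; dis-≈ = ≈ᴴ-sym (dis-≈ e) }

  tran : ∀ {s t u} → SameCreature s t → SameCreature t u → SameCreature s u
  tran {u = u} e e′ = record
    { dom-≡  = trans (dom-≡ e) (dom-≡ e′)
    ; sval-⇔ = sval-trans (dom-≡ e) (dom-≡ e′) {R = SemiCreature.sval u} (sval-⇔ e) (sval-⇔ e′)
    ; nor-≤  = ≤⁺-trans (nor-≤ e) (nor-≤ e′)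
    ; nor-≥  = ≤⁺-trans (nor-≥ e′) (nor-≥ e)
    ; dis-≈  = ≈ᴴ-trans (dis-≈ e) (dis-≈ e′) }

------------------------------------------------------------------------
-- Semi-creating triples.  A finite subset of K is a list of members of
-- K, taken up to order, repetition and equality of semi-creatures; the
-- resp fields and the congruence premise on f in compose say that only
-- the finite set matters, not the list presenting it.  The premises sub
-- are inhabited because of dom-⋃.

module Members {H : ℕ → Set} {ℓ} (K : Pred (SemiCreature H) ℓ) where

  Creature : Set (lsuc 0ℓ ⊔ ℓ)
  Creature = ∃ K

  creatureSetoid : Setoid (lsuc 0ℓ ⊔ ℓ) (lsuc 0ℓ)
  creatureSetoid = On.setoid (semiCreatureSetoid H) (proj₁ {B = K})

  open Setoid creatureSetoid public
    using () renaming (_≈_ to _≈ᶜ_; refl to ≈ᶜ-refl; sym to ≈ᶜ-sym; trans to ≈ᶜ-trans)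

  private module C (t : Creature) = SemiCreature (proj₁ t)
  open C public using (dom; sval; nor)

  infix 4 _≋_

  _≋_ : Rel (List Creature) (lsuc 0ℓ ⊔ ℓ)
  S ≋ S′ = S ⊆ₛ S′ × S′ ⊆ₛ S
    where open SetoidSubset creatureSetoid renaming (_⊆_ to _⊆ₛ_)

record IsSemiComposition {H : ℕ → Set} {ℓ} (K : Pred (SemiCreature H) ℓ)
    (Σ : List (∃ K) → Pred (∃ K) ℓ) : Set (lsuc 0ℓ ⊔ ℓ) where
  open Members K
  field
    resp      : ∀ {S S′ t t′} → S ≋ S′ → t ≈ᶜ t′ → t U.∈ Σ S → t′ U.∈ Σ S′
    compose   : ∀ S (f : Creature → List Creature) → (∀ {s s′} → s ≈ᶜ s′ → f s ≋ f s′) →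
                (∀ s → s ∈ S → s U.∈ Σ (f s)) → Σ S U.⊆ Σ (concatMap f S)
    self      : ∀ t → t U.∈ Σ [ t ]
    Σ∅≡∅      : ∀ t → t U.∉ Σ []
    dom-⋃     : ∀ {S t} → t U.∈ Σ S → dom t ∼[ set ] concatMap dom S
    restrict  : ∀ {S t} → t U.∈ Σ S → ∀ v → v U.∈ sval t →
                ∀ s → s ∈ S → (sub : dom s ⊆ dom t) → (v ↾ sub) U.∈ sval s
    disjoint  : ∀ {S t} → t U.∈ Σ S → ∀ s s′ → s ∈ S → s′ ∈ S → ¬ s ≈ᶜ s′ →
                Disjoint (dom s) (dom s′)

record IsSemiDecomposition {H : ℕ → Set} {ℓ} (K : Pred (SemiCreature H) ℓ)
    (Σ⊥ : ∃ K → Pred (List (∃ K)) ℓ) : Set (lsuc 0ℓ ⊔ ℓ) where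
  open Members K
  field
    resp      : ∀ {S S′ t t′} → S ≋ S′ → t ≈ᶜ t′ → S U.∈ Σ⊥ t → S′ U.∈ Σ⊥ t′
    nonempty  : ∀ t → ∃ λ S → S U.∈ Σ⊥ t
    compose   : ∀ {t} S (f : Creature → List Creature) → (∀ {s s′} → s ≈ᶜ s′ → f s ≋ f s′) →
                S U.∈ Σ⊥ t → (∀ s → s ∈ S → f s U.∈ Σ⊥ s) → concatMap f S U.∈ Σ⊥ t
    self      : ∀ t → [ t ] U.∈ Σ⊥ t
    dom-⋃     : ∀ {S t} → S U.∈ Σ⊥ t → dom t ∼[ set ] concatMap dom S
    amalgam   : ∀ {S t} → S U.∈ Σ⊥ t → (v : All H (dom t)) →
                (∀ s → s ∈ S → (sub : dom s ⊆ dom t) → (v ↾ sub) U.∈ sval s) → v U.∈ sval t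

record SemiCreatingTriple (H : ℕ → Set) (ℓ : Level) : Set (lsuc (lsuc 0ℓ ⊔ ℓ)) where
  field
    K                   : Pred (SemiCreature H) ℓ
    Σ                   : List (∃ K) → Pred (∃ K) ℓ
    Σ⊥                  : ∃ K → Pred (List (∃ K)) ℓ
    isSemiComposition   : IsSemiComposition K Σ
    isSemiDecomposition : IsSemiDecomposition K Σ⊥
  open Members K public

module _ {H : ℕ → Set} {ℓ} (𝒯 : SemiCreatingTriple H ℓ) where
  open SemiCreatingTriple 𝒯

  private
    1ℝ : ℝ∞
    1ℝ = fin (fromℚ 1ℚ)

  Linked : Set (lsuc 0ℓ ⊔ ℓ)
  Linked = ∀ t₀ t₁ → 1ℝ <⁺ nor t₀ → 1ℝ <⁺ nor t₁ → dom t₀ ∼[ set ] dom t₁ →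
    ∃ λ s → s U.∈ Σ [ t₀ ] × s U.∈ Σ [ t₁ ] × (nor t₀ ⊓⁺ nor t₁) −1 ≤⁺ nor s

  SemiGluing : Set (lsuc 0ℓ ⊔ ℓ)
  SemiGluing = ∀ (ts : List⁺ Creature) →
    AllPairs (λ t t′ → Disjoint (dom t) (dom t′)) (List⁺.toList ts) →
    ∃ λ s → s U.∈ Σ (List⁺.toList ts) × List⁺.foldr₁ _⊓⁺_ (List⁺.map nor ts) −1 ≤⁺ nor s

  CuttingProperty : Set (lsuc 0ℓ ⊔ ℓ)
  CuttingProperty = ∀ t → 1ℝ <⁺ nor t → ∀ (z : List ℕ) → z ≢ [] → z ⊆ dom t → ¬ (dom t ⊆ z) →
    ∃ λ s₀ → ∃ λ s₁ →
      dom s₀ ∼[ set ] z × (∀ i → i ∈ dom s₁ ⇔ (i ∈ dom t × i ∉ z)) ×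
      nor t −1 ≤⁺ nor s₀ × nor t −1 ≤⁺ nor s₁ × (s₀ ∷ s₁ ∷ []) U.∈ Σ⊥ t

-- Strict increase of dom makes propositional equality of this record
-- coincide with equality of functions.
record FiniteFunction (H : ℕ → Set) : Set where
  field
    dom        : List ℕ
    dom-sorted : AllPairs ℕ._<_ dom
    values     : All H dom

module Forcing {H : ℕ → Set} {ℓ} (𝒯 : SemiCreatingTriple H ℓ) where
  open SemiCreatingTriple 𝒯
  open FiniteFunction using (values) renaming (dom to domʷ)

  record Condition : Set (lsuc 0ℓ ⊔ ℓ) where
    field
      w          : FiniteFunction H
      t          : ℕ → Creature
      covering   : ∀ n → n ∈ domʷ w ⊎ ∃ λ i → n ∈ dom (t i)
      disjoint-w : ∀ i → Disjoint (domʷ w) (dom (t i))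
      disjoint-t : ∀ i j → i ≢ j → Disjoint (dom (t i)) (dom (t j))
      nor-finite : ∀ i → nor (t i) ≢ ∞
      nor-limit  : ∀ (M : ℝ) → ∃ λ N → ∀ i → N ℕ.≤ i → fin M <⁺ nor (t i)

  open Condition

  record _≈_ (p q : Condition) : Set (lsuc 0ℓ) where
    constructor _,_
    field
      w-≡ : w p ≡ w q
      t-≈ : ∀ i → t p i ≈ᶜ t q i

  -- The sets A i used by Σ and Σ⊥ are not asked to exhaust ω: that follows
  -- from p and q being conditions, as domains of creatures are non-empty.
  PairwiseDisjoint : (ℕ → List ℕ) → Set
  PairwiseDisjoint A = ∀ i j → i ≢ j → Disjoint (A i) (A j)

  -- The creatures t p i with i ∉ A may be re-enumerated in any order.
  record DecidesValue (p q : Condition) : Set (lsuc 0ℓ) where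
    field
      A       : List ℕ
      dom-w   : domʷ (w q) ∼[ set ] domʷ (w p) ++ concatMap (λ i → dom (t p i)) A
      extends : (sub : domʷ (w p) ⊆ domʷ (w q)) → values (w q) ↾ sub ≡ values (w p)
      decided : ∀ i → i ∈ A → (sub : dom (t p i) ⊆ domʷ (w q)) →
                (values (w q) ↾ sub) U.∈ sval (t p i)
      kept    : ∀ i → i ∉ A → ∃ λ j → t q j ≈ᶜ t p i
      only    : ∀ j → ∃ λ i → i ∉ A × t q j ≈ᶜ t p i

  record AppliesΣ (p q : Condition) : Set ℓ where
    field
      w-≡        : w q ≡ w p
      A          : ℕ → List ℕ
      A-disjoint : PairwiseDisjoint A
      composed   : ∀ i → t q i U.∈ Σ (map (t p) (A i))

  record AppliesΣ⊥ (p q : Condition) : Set ℓ where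
    field
      w-≡        : w q ≡ w p
      A          : ℕ → List ℕ
      A-disjoint : PairwiseDisjoint A
      A-nonempty : ∀ i → A i ≢ []
      decomposed : ∀ i → map (t q) (A i) U.∈ Σ⊥ (t p i)

  data _⟶_ (p q : Condition) : Set (lsuc 0ℓ ⊔ ℓ) where
    decide : DecidesValue p q → p ⟶ q
    apply  : AppliesΣ p q     → p ⟶ q
    split  : AppliesΣ⊥ p q    → p ⟶ q

  _≤Q_ : Rel Condition (lsuc 0ℓ ⊔ ℓ)
  _≤Q_ = Star _⟶_

  ≈⇒⟶ : ∀ {p q} → p ≈ q → p ⟶ q
  ≈⇒⟶ (w-≡ , t-≈) = apply (record
    { w-≡        = sym w-≡
    ; A          = [_]
    ; A-disjoint = λ { i j i≢j (here refl , here v≡j) → i≢j v≡j }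
    ; composed   = λ i → IsSemiComposition.resp isSemiComposition
        (id , id) (t-≈ i) (IsSemiComposition.self isSemiComposition _)
    })

  forcing : Preorder (lsuc 0ℓ ⊔ ℓ) (lsuc 0ℓ) (lsuc 0ℓ ⊔ ℓ)
  forcing = record
    { Carrier    = Condition
    ; _≈_        = _≈_
    ; _≲_        = _≤Q_
    ; isPreorder = record
      { isEquivalence = record
        { refl  = λ {p} → refl , λ i → ≈ᶜ-refl {x = t p i}
        ; sym   = λ { {p} {q} (e , f) → sym e , λ i → ≈ᶜ-sym {t p i} {t q i} (f i) }
        ; trans = λ { {p} {q} {r} (e , f) (e′ , f′) →
                      trans e e′ , λ i → ≈ᶜ-trans {t p i} {t q i} {t r i} (f i) (f′ i) }
        }
      ; reflexive = λ p≈q → ≈⇒⟶ p≈q ◅ ε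
      ; trans     = _◅◅_
      }
    }

ℚ⁺∞ : {H : ℕ → Set} {ℓ : Level} → SemiCreatingTriple H ℓ →
      Preorder (lsuc 0ℓ ⊔ ℓ) (lsuc 0ℓ) (lsuc 0ℓ ⊔ ℓ)
ℚ⁺∞ = Forcing.forcing

------------------------------------------------------------------------
-- σ-*-linkedness.  p ≲ q means that q is the stronger condition, and a
-- piece of a partition may be empty.

module _ {c ℓ₁ ℓ₂} (Q : Preorder c ℓ₁ ℓ₂) where
  open Preorder Q

  record IsPartition (A : ℕ → Pred Carrier 0ℓ) : Set (c ⊔ ℓ₁) where
    field
      respects : ∀ {i p q} → p ≈ q → p U.∈ A i → q U.∈ A i
      covers   : ∀ q → ∃ λ i → q U.∈ A i
      disjoint : ∀ {i j q} → q U.∈ A i → q U.∈ A j → i ≡ j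

  σ-*-Linked : Set (lsuc 0ℓ ⊔ c ⊔ ℓ₁ ⊔ ℓ₂)
  σ-*-Linked = ∀ (n : ℕ) → ∃ λ (A : ℕ → Pred Carrier 0ℓ) → IsPartition A ×
    (∀ i (q : Fin (ℕ.suc n) → Carrier) → (∀ k → q k U.∈ A i) → ∃ λ r → ∀ k → q k ≲ r)

{-# OPTIONS --safe #-}

-- Deciding finitely many creatures, every condition p has a strengthening p′
-- in which all norms exceed n + 4; p is classified by the least possible code
-- of w p′.  So let conditions p₀ , … , pₙ have the same w and all norms above
-- n + 4.  Choose c₀ < c₁ < … so fast that, in each pₖ, creatures can be glued
-- along consecutive blocks of indices, the j-th block reaching at most from
-- c₍ⱼ₋₁₎ to c₍ⱼ₊₁₎.  Cut the j-th glued creature at cⱼ and glue its upper piece to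
-- the lower piece of the next one: the result has domain [cⱼ , c₍ⱼ₊₁₎) ∖ dom w in
-- every pₖ.  This costs 3 in the norms, and n further losses of 1 link the
-- n + 1 creatures on each of these common domains.
--
-- Gluing before cutting keeps the norms of the pieces finite: cutting a
-- creature of pₖ directly may produce a piece of norm ∞, which no condition
-- contains.
module Submission where

open import Defs
open import Axiom.ExcludedMiddle using (ExcludedMiddle)
open import Data.Fin.Base using (Fin; zero; suc)
open import Data.List.Base using (List; []; _∷_; [_]; _++_; map; concatMap; filter; upTo; tabulate)
open import Data.List.Extrema.Nat using (max; xs≤max)
open import Data.List.Membership.DecPropositional using () renaming (_∈?_ to mem?)
open import Data.List.Membership.Propositional using (_∈_; _∉_; find)
open import Data.List.Membership.Propositional.Properties
  using (∈-map⁺; ∈-map⁻; ∈-concatMap⁺; ∈-concatMap⁻; ∈-filter⁺; ∈-filter⁻; ∈-upTo⁺; ∈-upTo⁻;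
         ∈-tabulate⁺; ∈-++⁺ˡ; ∈-++⁺ʳ; ∈-++⁻)
open import Data.List.NonEmpty.Base as List⁺ using (List⁺)
open import Data.List.Properties using (++-identityʳ)
open import Data.List.Relation.Binary.BagAndSetEquality using (_∼[_]_; set)
open import Data.List.Relation.Binary.Disjoint.Propositional using (Disjoint)
open import Data.List.Relation.Binary.Subset.Propositional using (_⊆_)
open import Data.List.Relation.Unary.All as All using (All; []; _∷_)
open import Data.List.Relation.Unary.AllPairs as AllPairs using (AllPairs; []; _∷_)
import Data.List.Relation.Unary.AllPairs.Properties as AllPairs
open import Data.List.Relation.Unary.Any as Any using (here; there)
open import Data.List.Relation.Unary.Unique.Propositional using (Unique)
import Data.List.Relation.Unary.Unique.Propositional.Properties as Unique
open import Data.Nat.Base as ℕ using (ℕ; zero; suc; _+_; z≤n; s≤s)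
import Data.Nat.Properties as ℕ
open import Data.Product.Base using (∃; ∃₂; _×_; _,_; proj₁; proj₂)
open import Data.Rational.Base as ℚ using (ℚ; 1ℚ)
import Data.Rational.Properties as ℚ
open import Data.Sum.Base as Sum using (_⊎_; inj₁; inj₂; [_,_]′)
open import Data.Unit.Base using (⊤; tt)
open import Function.Base using (_∘_; id; case_of_)
open import Function.Bundles using (_⇔_; _↣_; Equivalence; mk⇔; Injection)
open import Level using (Level)
open import Relation.Binary.Bundles using (Preorder)
open import Relation.Binary.Construct.Closure.ReflexiveTransitive using (ε; _◅_; _◅◅_)
open import Relation.Binary.Definitions using (tri<; tri≈; tri>)
open import Relation.Binary.PropositionalEquality
  using (_≡_; _≢_; refl; sym; trans; cong; cong₂; subst; module ≡-Reasoning)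
open import Relation.Nullary.Construct.Add.Supremum using () renaming ([_] to fin; ⊤⁺ to ∞)
open import Relation.Nullary using (yes; no; contradiction)
import Relation.Unary as U

open Equivalence using (to; from)

-- Least numbers, finite bounds and a pairing function

least : (∀ {a} → ExcludedMiddle a) → ∀ {a} (P : ℕ → Set a) → ∃ P →
        ∃ λ n → P n × (∀ m → P m → n ℕ.≤ m)
least em P (n , Pn) = search n P Pn
  where
  search : ∀ n (P : ℕ → Set _) → P n → ∃ λ n → P n × (∀ m → P m → n ℕ.≤ m)
  search zero    P Pn = zero , Pn , λ _ _ → z≤n
  -- The only appeal to excluded middle: `P` will be `Reaches p`, which comes with no decision
  -- procedure.
  search (suc n) P Pn with em {P = P zero}
  ... | yes P0 = zero , P0 , λ _ _ → z≤n
  ... | no ¬P0 =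
    let m , Pm , m-least = search n (P ∘ suc) Pn
    in suc m , Pm , λ { zero P0 → contradiction P0 ¬P0 ; (suc k) Pk → s≤s (m-least k Pk) }

bound : List ℕ → ℕ
bound xs = suc (max 0 xs)

∈⇒<bound : ∀ {x xs} → x ∈ xs → x ℕ.< bound xs
∈⇒<bound {xs = xs} x∈xs = s≤s (All.lookup (xs≤max 0 xs) x∈xs)

sup : ∀ {m} → (Fin m → ℕ) → ℕ
sup f = max 0 (tabulate f)

≤-sup : ∀ {m} (f : Fin m → ℕ) k → f k ℕ.≤ sup f
≤-sup f k = All.lookup (xs≤max 0 (tabulate f)) (∈-tabulate⁺ k)

-- pair a b = 2ᵃ (2b + 1)
pair : ℕ → ℕ → ℕ
pair zero    b = suc (b + b)
pair (suc a) b = pair a b + pair a b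

double-injective : ∀ a b → a + a ≡ b + b → a ≡ b
double-injective zero    zero    _  = refl
double-injective (suc a) (suc b) eq = cong suc (double-injective a b
  (ℕ.suc-injective (ℕ.suc-injective 
    (trans (cong suc (sym (ℕ.+-suc a a))) (trans eq (cong suc (ℕ.+-suc b b)))))))

double≢odd : ∀ a b → a + a ≢ suc (b + b)
double≢odd (suc a) zero    eq with () ← trans (sym (ℕ.+-suc a a)) (ℕ.suc-injective eq)
double≢odd (suc a) (suc b) eq = double≢odd a b
  (ℕ.suc-injective (trans (sym (ℕ.+-suc a a)) (trans (ℕ.suc-injective eq) (cong suc (ℕ.+-suc b b)))))

-- Parity tells the two clauses of `pair` apart, and halving peels off one factor 2.
pair-injective : ∀ a b c d → pair a b ≡ pair c d → a ≡ c × b ≡ d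
pair-injective zero    b zero    d eq = refl , double-injective b d (ℕ.suc-injective eq)
pair-injective zero    b (suc c) d eq = contradiction (sym eq) (double≢odd (pair c d) b)
pair-injective (suc a) b zero    d eq = contradiction eq (double≢odd (pair a b) d)
pair-injective (suc a) b (suc c) d eq =
  let a≡c , b≡d = pair-injective a b c d (double-injective _ _ eq) in cong suc a≡c , b≡d

-- Codes of finite functions; assignments as restrictions of total functions

module _ {H : ℕ → Set} where

  module _ (code : ∀ i → H i ↣ ℕ) where

    encode : ∀ {d} → All H d → ℕ
    encode []                 = 0
    encode {i ∷ _} (v ∷ vs) = suc (pair i (pair (Injection.to (code i) v) (encode vs)))

    -- Each value is coded together with its index, so the code determines the domain as well. The
    -- equation lives in `∃ (All H)` because `d` and `e` are not known to agree beforehand.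
    encode-injective : ∀ {d e} (v : All H d) (u : All H e) → encode v ≡ encode u →
                       _≡_ {A = ∃ (All H)} (d , v) (e , u)
    encode-injective []       []       eq = refl
    encode-injective []       (_ ∷ _)  ()
    encode-injective (_ ∷ _)  []       ()
    encode-injective {i ∷ _} {j ∷ _} (v ∷ vs) (u ∷ us) eq
      with pair-injective i _ j _ (ℕ.suc-injective eq)
    ... | refl , eq′ with pair-injective _ (encode vs) _ (encode us) eq′
    ... | v≡u , vs≡us with Injection.injective (code i) v≡u | encode-injective vs us vs≡us
    ... | refl | refl = refl

    encodeʷ : FiniteFunction H → ℕ
    encodeʷ w = encode (FiniteFunction.values w)

    encodeʷ-injective : ∀ w u → encodeʷ w ≡ encodeʷ u → w ≡ u
    encodeʷ-injective w u eq =
      same (FiniteFunction.dom-sorted w) (FiniteFunction.dom-sorted u)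
           (encode-injective (FiniteFunction.values w) (FiniteFunction.values u) eq)
      where
      same : ∀ {d e} {v : All H d} {u : All H e} (p : AllPairs ℕ._<_ d) (q : AllPairs ℕ._<_ e) →
             _≡_ {A = ∃ (All H)} (d , v) (e , u) →
             _≡_ {A = FiniteFunction H} (record { dom = d ; dom-sorted = p ; values = v })
                                        (record { dom = e ; dom-sorted = q ; values = u })
      same p q refl with refl ← AllPairs.irrelevant ℕ.<-irrelevant p q = refl

  -- Assignments on different domains are compared as restrictions `All.universal h d` of total
  -- functions; this makes `↾` independent of inclusion proofs.
  override : ∀ {d} → All H d → (∀ i → H i) → ∀ i → H i
  override [] h i = h i
  override {x ∷ _} (v ∷ vs) h i with x ℕ.≟ i
  ... | yes refl = v
  ... | no  _    = override vs h i

  override-∉ : ∀ {d} (v : All H d) h {i} → i ∉ d → override v h i ≡ h i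
  override-∉ [] h i∉ = refl
  override-∉ {x ∷ _} (v ∷ vs) h {i} i∉ with x ℕ.≟ i
  ... | yes refl = contradiction (here refl) i∉
  ... | no  _    = override-∉ vs h (i∉ ∘ there)

  universal-cong : ∀ {h h′ : ∀ i → H i} d → (∀ {i} → i ∈ d → h i ≡ h′ i) →
                   All.universal h d ≡ All.universal h′ d
  universal-cong []      eq = refl
  universal-cong (x ∷ d) eq = cong₂ _∷_ (eq (here refl)) (universal-cong d (eq ∘ there))

  -- Sortedness makes the indices distinct; of a repeated index `override` would read only the first
  -- value.
  universal-override : ∀ {d} → AllPairs ℕ._<_ d → (v : All H d) (h : ∀ i → H i) →
                       All.universal (override v h) d ≡ v
  universal-override [] [] h = refl
  universal-override {x ∷ d} (x< ∷ d<) (v ∷ vs) h = cong₂ _∷_ head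
    (trans (universal-cong d tail) (universal-override d< vs h))
    where
    head : override (v ∷ vs) h x ≡ v
    head with x ℕ.≟ x
    ... | yes refl = refl
    ... | no  x≢x  = contradiction refl x≢x
    tail : ∀ {i} → i ∈ d → override (v ∷ vs) h i ≡ override vs h i
    tail {i} i∈d with x ℕ.≟ i
    ... | yes refl = contradiction (All.lookup x< i∈d) (ℕ.<-irrefl refl)
    ... | no  _    = refl

  universal-override-disjoint : ∀ {d e} (v : All H d) (h : ∀ i → H i) → Disjoint d e →
                                All.universal (override v h) e ≡ All.universal h e
  universal-override-disjoint {e = e} v h d∩e =
    universal-cong e λ i∈e → override-∉ v h λ i∈d → d∩e (i∈d , i∈e)

  universal-↾ : ∀ (h : ∀ i → H i) d {e} (sub : d ⊆ e) → (All.universal h e ↾ sub) ≡ All.universal h d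
  universal-↾ h []      sub = refl
  universal-↾ h (x ∷ d) sub = 
    cong₂ _∷_ (lookup-universal (sub (here refl))) (universal-↾ h d (sub ∘ there))
    where
    lookup-universal : ∀ {x e} (x∈e : x ∈ e) → All.lookup (All.universal h e) x∈e ≡ h x
    lookup-universal (here refl)  = refl
    lookup-universal (there x∈e) = lookup-universal x∈e

-- Rational lower bounds of norms

infix 4 _◃_

-- Strict inequality between a rational and a norm: lower cuts are open, so membership in the cut is
-- already strict.
_◃_ : ℚ → ℝ∞ → Set
q ◃ fin x = ℝ.cut x q
q ◃ ∞     = ⊤

<⁺⇒◃ : ∀ {q x} → fin (fromℚ q) <⁺ x → q ◃ x
<⁺⇒◃ {q} (fin< {l = x} (r , r≮q , r∈x)) with ℚ.<-cmp q r
... | tri< q<r _ _ = ℝ.lower x q<r r∈x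
... | tri≈ _ refl _ = r∈x
... | tri> _ _ r<q = contradiction r<q r≮q
<⁺⇒◃ [ _ ]<⊤⁺ = tt

◃⇒<⁺ : ∀ {q x y} → q U.∉ ℝ.cut x → q ◃ y → fin x <⁺ y
◃⇒<⁺ {y = fin y} q∉x q∈y = fin< (_ , q∉x , q∈y)
◃⇒<⁺ {y = ∞}     _   _   = [ _ ]<⊤⁺

◃-≤⁺ : ∀ {q x y} → x ≤⁺ y → q ◃ x → q ◃ y
◃-≤⁺ (fin≤ x≤y) q◃x = x≤y q◃x
◃-≤⁺ (_ ≤⊤⁺)    _   = tt

◃-⊓⁺ : ∀ {q} x y → q ◃ x → q ◃ y → q ◃ x ⊓⁺ y
◃-⊓⁺ (fin x) (fin y) q◃x q◃y = q◃x , q◃y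
◃-⊓⁺ (fin x) ∞       q◃x _   = q◃x
◃-⊓⁺ ∞       y       _   q◃y = q◃y

-- The form in which the bounds from linking, gluing and cutting are used: each costs 1.
◃-−1 : ∀ {q} x {y} → x −1 ≤⁺ y → q ℚ.+ 1ℚ ◃ x → q ◃ y
◃-−1 (fin x) x−1≤y q+1◃x = ◃-≤⁺ x−1≤y q+1◃x
◃-−1 ∞       ∞≤y   _     = ◃-≤⁺ ∞≤y tt

◃-pred : ∀ {q} x → q ℚ.+ 1ℚ ◃ x → q ◃ x
◃-pred {q} (fin x) = ℝ.lower x
  (subst (ℚ._< q ℚ.+ 1ℚ) (ℚ.+-identityʳ q) (ℚ.+-monoʳ-< q (ℚ.positive⁻¹ 1ℚ)))
◃-pred     ∞       _ = tt

-- This is q + n. The units are added to `q` first, so that the induction in `link` can use its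
-- hypothesis at `q ℚ.+ 1ℚ` without rewriting.
_⊕_ : ℚ → ℕ → ℚ
q ⊕ zero  = q
q ⊕ suc n = (q ℚ.+ 1ℚ) ⊕ n

◃-⊕ : ∀ {q} n x → q ⊕ n ◃ x → q ◃ x
◃-⊕ zero    x = id
◃-⊕ (suc n) x = ◃-pred x ∘ ◃-⊕ n x

◃-⊕-pred : ∀ {q} n x → (q ℚ.+ 1ℚ) ⊕ n ◃ x → q ⊕ n ◃ x
◃-⊕-pred zero    x = ◃-pred x
◃-⊕-pred (suc n) x = ◃-⊕-pred n x

-- Partitions of ω into non-empty finite blocks

record Grouping : Set where
  field
    members   : ℕ → List ℕ
    index     : ℕ → ℕ
    ∈-members : ∀ i → i ∈ members (index i)
    index-≡   : ∀ {i j} → i ∈ members j → index i ≡ j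
    nonempty  : ∀ j → members j ≢ []
    -- Gluing asks for pairwise disjoint domains, which a repeated index would spoil.
    unique    : ∀ j → Unique (members j)

  members-disjoint : ∀ i j → i ≢ j → Disjoint (members i) (members j)
  members-disjoint i j i≢j (a∈i , a∈j) = i≢j (trans (sym (index-≡ a∈i)) (index-≡ a∈j))

  -- The numbers below `N` meet only finitely many blocks. This preserves the divergence of norms
  -- under gluing.
  late : ∀ N → ∃ λ J → ∀ {i j} → J ℕ.≤ j → i ∈ members j → N ℕ.≤ i
  late N = bound (map index (upTo N)) , λ {i} J≤j i∈j → ℕ.≮⇒≥ λ i<N →
    ℕ.<⇒≱ (∈⇒<bound (∈-map⁺ index (∈-upTo⁺ i<N))) (subst (_ ℕ.≤_) (sym (index-≡ i∈j)) J≤j)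

  -- The first `N` blocks have finitely many members. This preserves the divergence of norms under
  -- cutting.
  early : ∀ N → ∃ λ J → ∀ {i j} → J ℕ.≤ i → i ∈ members j → N ℕ.≤ j
  early N = bound (concatMap members (upTo N)) , λ {i} J≤i i∈j → ℕ.≮⇒≥ λ j<N →
    ℕ.<⇒≱ (∈⇒<bound (∈-concatMap⁺ members (Any.map (λ { refl → i∈j }) (∈-upTo⁺ j<N)))) J≤i

module _ (e : ℕ → ℕ) (e-zero : e 0 ≡ 0) (e-< : ∀ j → e j ℕ.< e (suc j)) where

  private
    Between : ℕ → ℕ → Set
    Between i j = e j ℕ.≤ i × i ℕ.< e (suc j)

    locate : ∀ i → ∃ (Between i)
    locate zero    = 0 , ℕ.≤-reflexive e-zero , ℕ.≤-<-trans z≤n (e-< 0)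
    locate (suc i) with locate i
    ... | j , lo , hi with suc i ℕ.<? e (suc j)
    ...   | yes lt = j , ℕ.m≤n⇒m≤1+n lo , lt
    -- Here `hi` says that `suc i` is at most `e (suc j)`, so `suc i` starts the next block.
    ...   | no ≮   = suc j , ℕ.≮⇒≥ ≮ , ℕ.≤-<-trans hi (e-< (suc j))

    e-mono : ∀ {i j} → i ℕ.≤′ j → e i ℕ.≤ e j
    e-mono ℕ.≤′-refl       = ℕ.≤-refl
    e-mono (ℕ.≤′-step i≤j) = ℕ.≤-trans (e-mono i≤j) (ℕ.<⇒≤ (e-< _))

    between-≡ : ∀ {i j k} → Between i j → Between i k → j ≡ k
    between-≡ {j = j} {k} (lo , hi) (lo′ , hi′) with ℕ.<-cmp j k
    ... | tri< j<k _ _ = contradiction lo′ (ℕ.<⇒≱ (ℕ.<-≤-trans hi (e-mono (ℕ.≤⇒≤′ j<k))))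
    ... | tri≈ _ eq _  = eq
    ... | tri> _ _ k<j = contradiction lo (ℕ.<⇒≱ (ℕ.<-≤-trans hi′ (e-mono (ℕ.≤⇒≤′ k<j))))

    interval : ℕ → List ℕ
    interval j = filter (e j ℕ.≤?_) (upTo (e (suc j)))

    ∈⇒between : ∀ {i j} → i ∈ interval j → Between i j
    ∈⇒between {j = j} i∈ = let i∈upTo , lo = ∈-filter⁻ (e j ℕ.≤?_) i∈ in lo , ∈-upTo⁻ i∈upTo

    between⇒∈ : ∀ {i j} → Between i j → i ∈ interval j
    between⇒∈ {j = j} (lo , hi) = ∈-filter⁺ (e j ℕ.≤?_) (∈-upTo⁺ hi) lo

  intervals : Grouping
  intervals = record
    { members   = interval
    ; index     = proj₁ ∘ locate
    ; ∈-members = between⇒∈ ∘ proj₂ ∘ locate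
    ; index-≡   = λ i∈ → between-≡ (proj₂ (locate _)) (∈⇒between i∈)
    ; nonempty  = λ j eq → case subst (e j ∈_) eq (between⇒∈ (ℕ.≤-refl , e-< j)) of λ ()
    ; unique    = λ j → Unique.filter⁺ (e j ℕ.≤?_) (Unique.upTo⁺ (e (suc j)))
    }

  ∈-interval⁻ : ∀ {i j} → i ∈ Grouping.members intervals j → e j ℕ.≤ i × i ℕ.< e (suc j)
  ∈-interval⁻ = ∈⇒between

  ∈-interval⁺ : ∀ {i j} → e j ℕ.≤ i → i ℕ.< e (suc j) → i ∈ Grouping.members intervals j
  ∈-interval⁺ lo hi = between⇒∈ (lo , hi)

-- Unlike `n + n`, this unfolds to two successors at `suc n`, in step with `parity`.
double : ℕ → ℕ
double zero    = zero
double (suc n) = suc (suc (double n))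

-- The bijection of ω with two copies of itself; the even copy will number lower pieces of cuts, the
-- odd one upper pieces.
parity : ℕ → ℕ ⊎ ℕ
parity zero          = inj₁ zero
parity (suc zero)    = inj₂ zero
parity (suc (suc n)) = Sum.map suc suc (parity n)

parity-double : ∀ n → parity (double n) ≡ inj₁ n
parity-double zero    = refl
parity-double (suc n) = cong (Sum.map suc suc) (parity-double n)

parity-suc-double : ∀ n → parity (suc (double n)) ≡ inj₂ n
parity-suc-double zero    = refl
parity-suc-double (suc n) = cong (Sum.map suc suc) (parity-suc-double n)

join-parity : ∀ n → [ double , suc ∘ double ]′ (parity n) ≡ n
join-parity zero          = refl
join-parity (suc zero)    = refl
join-parity (suc (suc n)) with parity n | join-parity n
... | inj₁ _ | refl = refl
... | inj₂ _ | refl = refl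

singletons : Grouping
singletons = record
  { members   = [_]
  ; index     = id
  ; ∈-members = λ _ → here refl
  ; index-≡   = λ { (here eq) → eq }
  ; nonempty  = λ _ ()
  ; unique    = λ _ → [] ∷ []
  }

double≢suc-double : ∀ m n → double m ≢ suc (double n)
double≢suc-double m n eq
  with () ← trans (sym (parity-double m)) (trans (cong parity eq) (parity-suc-double n))

-- The `j`-th block numbers the two pieces of the `j`-th creature that is cut.
evenPairs : Grouping
evenPairs = record
  { members   = λ j → double j ∷ suc (double j) ∷ []
  ; index     = [ id , id ]′ ∘ parity
  ; ∈-members = member
  ; index-≡   = λ { {j = j} (here refl) → cong [ id , id ]′ (parity-double j)
                  ; {j = j} (there (here refl)) → cong [ id , id ]′ (parity-suc-double j) }
  ; nonempty  = λ _ ()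
  ; unique    = λ j → (double≢suc-double j j ∷ []) ∷ [] ∷ []
  }
  where
  member : ∀ i → let j = [ id , id ]′ (parity i) in i ∈ double j ∷ suc (double j) ∷ []
  member i with parity i | join-parity i
  ... | inj₁ _ | refl = here refl
  ... | inj₂ _ | refl = there (here refl)

-- These blocks join the upper piece of creature `j` to the lower piece of creature `suc j`; the
-- first lower piece stays alone.
oddPairs : Grouping
oddPairs = record
  { members   = group
  ; index     = [ id , suc ]′ ∘ parity
  ; ∈-members = member
  ; index-≡   = λ {_} {j} → index-≡ j
  ; nonempty  = λ { zero () ; (suc _) () }
  ; unique    = λ
      { zero    → [] ∷ []
      ; (suc j) → ((λ eq → double≢suc-double (suc j) j (sym eq)) ∷ []) ∷ [] ∷ []
      }
  }
  where
  group : ℕ → List ℕ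
  group zero    = zero ∷ []
  group (suc j) = suc (double j) ∷ double (suc j) ∷ []
  index-≡ : ∀ {i} j → i ∈ group j → [ id , suc ]′ (parity i) ≡ j
  index-≡ zero    (here refl)         = refl
  index-≡ (suc j) (here refl)         = cong [ id , suc ]′ (parity-suc-double j)
  index-≡ (suc j) (there (here refl)) = cong [ id , suc ]′ (parity-double (suc j))
  member : ∀ i → i ∈ group ([ id , suc ]′ (parity i))
  member i with parity i | join-parity i
  ... | inj₁ zero    | refl = here refl
  ... | inj₁ (suc _) | refl = there (here refl)
  ... | inj₂ _       | refl = here refl

-- Infinite norms under composition and decomposition

module _ {H : ℕ → Set} {ℓ} (𝒯 : SemiCreatingTriple H ℓ) (pick : ∀ i → H i) where

  open SemiCreatingTriple 𝒯
  open Forcing 𝒯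
  open Condition
  private
    module Comp = IsSemiComposition isSemiComposition
    module Dec = IsSemiDecomposition isSemiDecomposition

  dom-sorted : ∀ t → AllPairs ℕ._<_ (dom t)
  dom-sorted t = SemiCreature.dom-sorted (proj₁ t)

  ∃∈dom : ∀ t → ∃ λ x → x ∈ dom t
  ∃∈dom t = inhabitant (dom t) (SemiCreature.dom-nonempty (proj₁ t))
    where
    inhabitant : (xs : List ℕ) → xs ≢ [] → ∃ λ x → x ∈ xs
    inhabitant []      xs≢[] = contradiction refl xs≢[]
    inhabitant (x ∷ _) _     = x , here refl

  ∈-⋃dom⁺ : ∀ {S s x} → s ∈ S → x ∈ dom s → x ∈ concatMap dom S
  ∈-⋃dom⁺ s∈S x∈s = ∈-concatMap⁺ dom (Any.map (λ { refl → x∈s }) s∈S)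

  ∈-⋃dom⁻ : ∀ {S x} → x ∈ concatMap dom S → ∃ λ s → s ∈ S × x ∈ dom s
  ∈-⋃dom⁻ {S} x∈ = find (∈-concatMap⁻ dom {xs = S} x∈)

  ∞⇒∈sval : ∀ t → nor t ≡ ∞ → ∀ v → v U.∈ sval t
  ∞⇒∈sval t = from (SemiCreature.full⇔∞ (proj₁ t))

  -- Every assignment on `dom t` extends to a total function, with `pick` as default.
  total∈sval⇒∞ : ∀ t → (∀ h → All.universal h (dom t) U.∈ sval t) → nor t ≡ ∞
  total∈sval⇒∞ t h∈ = to (SemiCreature.full⇔∞ (proj₁ t)) λ v →
    subst (sval t) (universal-override (dom-sorted t) v pick) (h∈ (override v pick))

  Σ-⊆dom : ∀ {S t s} → t U.∈ Σ S → s ∈ S → dom s ⊆ dom t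
  Σ-⊆dom {t = t} t∈ s∈ x∈s = from (Comp.dom-⋃ {t = t} t∈) (∈-⋃dom⁺ s∈ x∈s)

  -- Norm ∞ means that all assignments are allowed, and `restrict` passes this down to `dom s`. Read
  -- contrapositively, gluing creatures of finite norm yields finite norms.
  Σ-∞ : ∀ {S t s} → t U.∈ Σ S → s ∈ S → nor t ≡ ∞ → nor s ≡ ∞
  Σ-∞ {S} {t} {s} t∈ s∈ t≡∞ = total∈sval⇒∞ s λ h →
    subst (sval s) (universal-↾ h (dom s) sub)
      (Comp.restrict {t = t} t∈ (All.universal h (dom t)) (∞⇒∈sval t t≡∞ _) s s∈ sub)
    where
    sub : dom s ⊆ dom t
    sub = Σ-⊆dom {t = t} {s = s} t∈ s∈

  -- Join an arbitrary assignment on `dom s` to an allowed one on `dom s₁`; the domains do not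
  -- interfere. All pieces in `S′` accept the result, those of norm ∞ trivially. Hence `g` accepts
  -- it by `amalgam`, and `s` by `restrict`.
  Σ⊥-∞ : ∀ {S S′ g s} s₁ → g U.∈ Σ S → S′ U.∈ Σ⊥ g → s ∈ S → Disjoint (dom s) (dom s₁) →
         (∀ s′ → s′ ∈ S′ → nor s′ ≡ ∞ ⊎ s′ ≡ s₁) → nor s ≡ ∞
  Σ⊥-∞ {S} {S′} {g} {s} s₁ g∈ S′∈ s∈ disj others = total∈sval⇒∞ s on-s
    where
    sub : dom s ⊆ dom g
    sub = Σ-⊆dom {t = g} {s = s} g∈ s∈
    v₁ : All H (dom s₁)
    v₁ = proj₁ (SemiCreature.sval-nonempty (proj₁ s₁))
    module _ (h : ∀ i → H i) where
      v : All H (dom s)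
      v = All.universal h (dom s)
      h₁ h′ : ∀ i → H i
      h₁ = override v₁ pick
      h′ = override v h₁
      restricts : ∀ s′ → s′ ∈ S′ → (sub′ : dom s′ ⊆ dom g) →
                  (All.universal h′ (dom g) ↾ sub′) U.∈ sval s′
      restricts s′ s′∈ sub′ with others s′ s′∈
      ... | inj₁ s′≡∞ = ∞⇒∈sval s′ s′≡∞ _
      ... | inj₂ refl = subst (sval s₁) (sym (begin
        All.universal h′ (dom g) ↾ sub′               ≡⟨ universal-↾ h′ (dom s₁) sub′ ⟩
        All.universal h′ (dom s₁)                     ≡⟨ universal-override-disjoint v h₁ disj ⟩
        All.universal h₁ (dom s₁)                     ≡⟨ universal-override (dom-sorted s₁) v₁ pick ⟩
        v₁                                            ∎))
        (proj₂ (SemiCreature.sval-nonempty (proj₁ s₁)))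
        where open ≡-Reasoning
      on-s : v U.∈ sval s
      on-s = subst (sval s)
        (trans (universal-↾ h′ (dom s) sub) (universal-override (dom-sorted s) _ _))
        (Comp.restrict {t = g} g∈ _
          (Dec.amalgam {t = g} S′∈ (All.universal h′ (dom g)) restricts) s s∈ sub)

  -- `compose` with a constant function, whose congruence premise is trivial; the union it produces
  -- is `S ++ []`.
  Σ-trans : ∀ {S u s} → s U.∈ Σ [ u ] → u U.∈ Σ S → s U.∈ Σ S
  Σ-trans {S} {u} {s} s∈ u∈ = subst (λ S → s U.∈ Σ S) (++-identityʳ S)
    (Comp.compose [ u ] (λ _ → S) (λ _ → id , id) (λ { _ (here refl) → u∈ }) s∈)

  -- Conditions obtained by composing along a partition

  Diverges : (ℕ → Creature) → Set
  Diverges u = ∀ q → ∃ λ N → ∀ i → N ℕ.≤ i → q ◃ nor (u i)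

  t-diverges : ∀ p → Diverges (t p)
  t-diverges p q = let N , large = nor-limit p (fromℚ q) in N , λ i N≤i → <⁺⇒◃ (large i N≤i)

  -- Rational bounds suffice, since the cut of `M` omits some rational.
  diverges⇒limit : ∀ u → Diverges u → ∀ M → ∃ λ N → ∀ i → N ℕ.≤ i → fin M <⁺ nor (u i)
  diverges⇒limit u div M =
    let q , q∉M = ℝ.bounded M ; N , large = div q in N , λ i N≤i → ◃⇒<⁺ q∉M (large i N≤i)

  owner-unique : ∀ p {i j x} → x ∈ dom (t p i) → x ∈ dom (t p j) → i ≡ j
  owner-unique p {i} {j} x∈i x∈j with i ℕ.≟ j
  ... | yes i≡j = i≡j
  ... | no  i≢j = contradiction (x∈i , x∈j) (disjoint-t p i j i≢j)

  module _ (p : Condition) (𝒢 : Grouping) where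
    open Grouping 𝒢

    dom-grouped⁻ : ∀ {u j x} → u U.∈ Σ (map (t p) (members j)) → x ∈ dom u →
                   ∃ λ i → i ∈ members j × x ∈ dom (t p i)
    dom-grouped⁻ {u} u∈ x∈u with ∈-⋃dom⁻ (to (Comp.dom-⋃ {t = u} u∈) x∈u)
    ... | s , s∈ , x∈s with ∈-map⁻ (t p) s∈
    ... | i , i∈ , refl = i , i∈ , x∈s

    dom-grouped⁺ : ∀ {u j x i} → u U.∈ Σ (map (t p) (members j)) → i ∈ members j →
                   x ∈ dom (t p i) → x ∈ dom u
    dom-grouped⁺ {u} u∈ i∈ = Σ-⊆dom {t = u} u∈ (∈-map⁺ (t p) i∈)

    -- Composition takes unions of domains, so covering and disjointness carry over from `p`, and
    -- `Σ-∞` keeps the norms finite. Only divergence has to be supplied.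
    grouped : (u : ℕ → Creature) → (∀ j → u j U.∈ Σ (map (t p) (members j))) → Diverges u → Condition
    grouped u u∈ div = record
      { w          = w p
      ; t          = u
      ; covering   = λ n → Sum.map₂
          (λ (i , n∈) → index i , dom-grouped⁺ (u∈ (index i)) (∈-members i) n∈) (covering p n)
      ; disjoint-w = λ j (x∈w , x∈j) →
          let i , _ , x∈i = dom-grouped⁻ (u∈ j) x∈j in disjoint-w p i (x∈w , x∈i)
      ; disjoint-t = λ j k j≢k (x∈j , x∈k) →
          let i , i∈j , x∈i = dom-grouped⁻ (u∈ j) x∈j
              l , l∈k , x∈l = dom-grouped⁻ (u∈ k) x∈k
          in j≢k (trans (sym (index-≡ i∈j)) (trans (cong index (owner-unique p x∈i x∈l)) (index-≡ l∈k)))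
      ; nor-finite = λ j u≡∞ →
          let x , x∈ = ∃∈dom (u j) ; i , i∈ , _ = dom-grouped⁻ (u∈ j) x∈
          in nor-finite p i (Σ-∞ {t = u j} (u∈ j) (∈-map⁺ (t p) i∈) u≡∞)
      ; nor-limit  = diverges⇒limit u div
      }

    -- Stated for an arbitrary `q` because in `linkAll` one condition, built from `p zero`, must be
    -- reached from every `p k`.
    ⟶-grouped : ∀ {u} q → w q ≡ w p → t q ≡ u → (∀ j → u j U.∈ Σ (map (t p) (members j))) → p ⟶ q
    ⟶-grouped q w≡ refl u∈ = apply (record
      { w-≡ = w≡ ; A = members ; A-disjoint = members-disjoint ; composed = u∈ })

    late-diverges : (u : ℕ → Creature) →
      (∀ {q} j → (∀ {i} → i ∈ members j → q ℚ.+ 1ℚ ◃ nor (t p i)) → q ◃ nor (u j)) → Diverges u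
    late-diverges u step q =
      let N , large = t-diverges p (q ℚ.+ 1ℚ) ; J , J-late = late N
      in J , λ j J≤j → step j λ i∈j → large _ (J-late J≤j i∈j)

  glue : SemiGluing 𝒯 → ∀ S → S ≢ [] → AllPairs (λ s s′ → Disjoint (dom s) (dom s′)) S →
         ∃ λ u → u U.∈ Σ S × (∀ {q} → (∀ s → s ∈ S → q ℚ.+ 1ℚ ◃ nor s) → q ◃ nor u)
  glue gluing []      S≢[] _    = contradiction refl S≢[]
  glue gluing (s ∷ S) _    disj =
    let u , u∈ , nor≤ = gluing (s List⁺.∷ S) disj
    in u , u∈ , λ large →
         ◃-−1 (List⁺.foldr₁ _⊓⁺_ (List⁺.map nor (s List⁺.∷ S))) nor≤ (◃-foldr₁ s S large)
    where
    ◃-foldr₁ : ∀ {q} s S → (∀ s′ → s′ ∈ s ∷ S → q ◃ nor s′) →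
               q ◃ List⁺.foldr₁ _⊓⁺_ (List⁺.map nor (s List⁺.∷ S))
    ◃-foldr₁ s []       large = large s (here refl)
    ◃-foldr₁ s (s′ ∷ S) large =
      ◃-⊓⁺ (nor s) _ (large s (here refl)) (◃-foldr₁ s′ S λ s″ s″∈ → large s″ (there s″∈))

  glueAll : SemiGluing 𝒯 → ∀ p (𝒢 : Grouping) → let open Grouping 𝒢 in
    ∃ λ p′ → p ⟶ p′ × w p′ ≡ w p × (∀ j → t p′ j U.∈ Σ (map (t p) (members j))) ×
             (∀ {q} → (∀ i → q ℚ.+ 1ℚ ◃ nor (t p i)) → ∀ j → q ◃ nor (t p′ j))
  glueAll gluing p 𝒢 =
    p′ , ⟶-grouped p 𝒢 p′ refl refl u∈ , refl , u∈ , λ large j → large-u j λ {i} _ → large i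
    where
    open Grouping 𝒢
    glued : ∀ j → _
    glued j = glue gluing (map (t p) (members j)) (map≢[] (nonempty j))
      (AllPairs.map⁺ (AllPairs.map (λ {i} {k} → disjoint-t p i k) (unique j)))
      where
      map≢[] : ∀ {xs} → xs ≢ [] → map (t p) xs ≢ []
      map≢[] {[]} xs≢[] _ = xs≢[] refl
    u : ℕ → Creature
    u = proj₁ ∘ glued
    u∈ : ∀ j → u j U.∈ Σ (map (t p) (members j))
    u∈ j = proj₁ (proj₂ (glued j))
    large-u : ∀ {q} j → (∀ {i} → i ∈ members j → q ℚ.+ 1ℚ ◃ nor (t p i)) → q ◃ nor (u j)
    large-u {q} j large = proj₂ (proj₂ (glued j)) λ s s∈ → large-s (∈-map⁻ (t p) s∈)
      where
      large-s : ∀ {s} → (∃ λ i → i ∈ members j × s ≡ t p i) → q ℚ.+ 1ℚ ◃ nor s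
      large-s (i , i∈ , refl) = large i∈
    p′ : Condition
    p′ = grouped p 𝒢 u u∈ (late-diverges p 𝒢 u large-u)

  -- Cutting all creatures of a condition

  record Cut (g : Creature) (c : ℕ) : Set (Level.suc Level.zero Level.⊔ ℓ) where
    field
      lower upper  : Creature
      lower-dom    : ∀ {x} → x ∈ dom lower ⇔ (x ∈ dom g × x ℕ.< c)
      upper-dom    : ∀ {x} → x ∈ dom upper ⇔ (x ∈ dom g × c ℕ.≤ x)
      lower-finite : nor lower ≢ ∞
      upper-finite : nor upper ≢ ∞
      lower-large  : ∀ {q} → q ℚ.+ 1ℚ ◃ nor g → q ◃ nor lower
      upper-large  : ∀ {q} → q ℚ.+ 1ℚ ◃ nor g → q ◃ nor upper
      cut∈         : (lower ∷ upper ∷ []) U.∈ Σ⊥ g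

  -- A piece of infinite norm would not be allowed in a condition.  It cannot
  -- arise since each side of the cut contains the domain of a glued creature of
  -- finite norm.
  cutAt : CuttingProperty 𝒯 → ∀ {S} g c → g U.∈ Σ S → 1ℚ ◃ nor g →
          ∀ a b → a ∈ S → b ∈ S → nor a ≢ ∞ → nor b ≢ ∞ →
          (∀ {x} → x ∈ dom a → x ℕ.< c) → (∀ {x} → x ∈ dom b → c ℕ.≤ x) → Cut g c
  cutAt cutting {S} g c g∈ 1◃g a b a∈ b∈ a≢∞ b≢∞ a< ≤b =
    let s₀ , s₁ , dom₀ , dom₁ , large₀ , large₁ , cut∈ =
          cutting g (◃⇒<⁺ (ℚ.<-irrefl refl) 1◃g) z z≢[] (proj₁ ∘ ∈-filter⁻ (ℕ._<? c)) g⊈z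
        lower-dom = λ {x} → mk⇔ (∈-filter⁻ (ℕ._<? c) ∘ to (dom₀ {x}))
                                (λ (x∈g , x<c) → from dom₀ (∈-filter⁺ (ℕ._<? c) x∈g x<c))
        upper-dom = λ {x} → mk⇔
          (λ x∈ → let x∈g , x∉z = to (dom₁ x) x∈ in x∈g , ℕ.≮⇒≥ (x∉z ∘ ∈-filter⁺ (ℕ._<? c) x∈g))
          (λ (x∈g , c≤x) → from (dom₁ x)
            (x∈g , λ x∈z → ℕ.<⇒≱ (proj₂ (∈-filter⁻ (ℕ._<? c) {xs = dom g} x∈z)) c≤x))
    in record
      { lower = s₀ ; upper = s₁ ; lower-dom = lower-dom ; upper-dom = upper-dom
      ; lower-finite = λ s₀≡∞ → a≢∞ (Σ⊥-∞ s₁ g∈ cut∈ a∈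
          (λ (x∈a , x∈s₁) → ℕ.<⇒≱ (a< x∈a) (proj₂ (to upper-dom x∈s₁)))
          λ { _ (here refl) → inj₁ s₀≡∞ ; _ (there (here refl)) → inj₂ refl })
      ; upper-finite = λ s₁≡∞ → b≢∞ (Σ⊥-∞ s₀ g∈ cut∈ b∈
          (λ (x∈b , x∈s₀) → ℕ.<⇒≱ (proj₂ (to lower-dom x∈s₀)) (≤b x∈b))
          λ { _ (here refl) → inj₂ refl ; _ (there (here refl)) → inj₁ s₁≡∞ })
      ; lower-large = λ q+1◃ → ◃-−1 (nor g) large₀ q+1◃
      ; upper-large = λ q+1◃ → ◃-−1 (nor g) large₁ q+1◃
      ; cut∈ = cut∈
      }
    where
    z : List ℕ
    z = filter (ℕ._<? c) (dom g)
    z≢[] : z ≢ []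
    z≢[] z≡[] = let x , x∈a = ∃∈dom a in
      case subst (x ∈_) z≡[] (∈-filter⁺ (ℕ._<? c) (Σ-⊆dom {t = g} g∈ a∈ x∈a) (a< x∈a)) of λ ()
    g⊈z : U.∁ (dom g ⊆_) z
    g⊈z g⊆z = let x , x∈b = ∃∈dom b in
      ℕ.<⇒≱ (proj₂ (∈-filter⁻ (ℕ._<? c) {xs = dom g} (g⊆z (Σ-⊆dom {t = g} g∈ b∈ x∈b)))) (≤b x∈b)

  module _ (p : Condition) (c : ℕ → ℕ) (cuts : ∀ j → Cut (t p j) (c j)) where
    private
      module Cuts j = Cut (cuts j)
      open Grouping evenPairs

      u : ℕ → Creature
      u = [ Cuts.lower , Cuts.upper ]′ ∘ parity

      u-even : ∀ j → u (double j) ≡ Cuts.lower j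
      u-even j = cong [ Cuts.lower , Cuts.upper ]′ (parity-double j)

      u-odd : ∀ j → u (suc (double j)) ≡ Cuts.upper j
      u-odd j = cong [ Cuts.lower , Cuts.upper ]′ (parity-suc-double j)

      dom-u : ∀ i {x} → x ∈ dom (u i) → x ∈ dom (t p (index i))
      dom-u i x∈ with parity i
      ... | inj₁ j = proj₁ (to (Cuts.lower-dom j) x∈)
      ... | inj₂ j = proj₁ (to (Cuts.upper-dom j) x∈)

      large-u : ∀ {q} i → q ℚ.+ 1ℚ ◃ nor (t p (index i)) → q ◃ nor (u i)
      large-u i with parity i
      ... | inj₁ j = Cuts.lower-large j
      ... | inj₂ j = Cuts.upper-large j

      u-finite : ∀ i → nor (u i) ≢ ∞
      u-finite i with parity i
      ... | inj₁ j = Cuts.lower-finite j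
      ... | inj₂ j = Cuts.upper-finite j

      piece : ∀ j x → ∃ λ i → x ∈ dom (t p j) → x ∈ dom (u i)
      piece j x with x ℕ.<? c j
      ... | yes x<c = double j , λ x∈ →
              subst (λ s → x ∈ dom s) (sym (u-even j)) (from (Cuts.lower-dom j) (x∈ , x<c))
      ... | no  x≮c = suc (double j) , λ x∈ →
              subst (λ s → x ∈ dom s) (sym (u-odd j)) (from (Cuts.upper-dom j) (x∈ , ℕ.≮⇒≥ x≮c))

      -- A common point forces both pieces to come from the same creature of `p`. Pieces on the same
      -- side then have equal numbers, and opposite sides are separated by the cut point.
      u-disjoint : ∀ i k → i ≢ k → Disjoint (dom (u i)) (dom (u k))
      u-disjoint i k i≢k {x} (x∈i , x∈k) with owner-unique p (dom-u i x∈i) (dom-u k x∈k)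
      ... | eq with parity i | parity k | join-parity i | join-parity k
      ... | inj₁ j | inj₁ _ | refl | refl = i≢k (cong double eq)
      ... | inj₂ j | inj₂ _ | refl | refl = i≢k (cong (suc ∘ double) eq)
      ... | inj₁ j | inj₂ _ | refl | refl with refl ← eq =
              ℕ.<⇒≱ (proj₂ (to (Cuts.lower-dom j) x∈i)) (proj₂ (to (Cuts.upper-dom j) x∈k))
      ... | inj₂ j | inj₁ _ | refl | refl with refl ← eq =
              ℕ.<⇒≱ (proj₂ (to (Cuts.lower-dom j) x∈k)) (proj₂ (to (Cuts.upper-dom j) x∈i))

    cutAll : ∃ λ p′ → p ⟶ p′ × w p′ ≡ w p ×
               (∀ j → t p′ (double j) ≡ Cut.lower (cuts j)) ×
               (∀ j → t p′ (suc (double j)) ≡ Cut.upper (cuts j)) ×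
               (∀ {q} → (∀ j → q ℚ.+ 1ℚ ◃ nor (t p j)) → ∀ i → q ◃ nor (t p′ i))
    cutAll = p′ , p⟶p′ , refl , u-even , u-odd , λ large i → large-u i (large (index i))
      where
      p′ : Condition
      p′ = record
        { w          = w p
        ; t          = u
        ; covering   = λ n → Sum.map₂ (λ (j , n∈) → let i , ∈u = piece j n in i , ∈u n∈) (covering p n)
        ; disjoint-w = λ i (x∈w , x∈i) → disjoint-w p (index i) (x∈w , dom-u i x∈i)
        ; disjoint-t = u-disjoint
        ; nor-finite = u-finite
        ; nor-limit  = diverges⇒limit u λ q →
            let N , large = t-diverges p (q ℚ.+ 1ℚ) ; J , J-early = early N
            in J , λ i J≤i → large-u i (large _ (J-early J≤i (∈-members i)))
        }
      p⟶p′ : p ⟶ p′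
      p⟶p′ = split (record
        { w-≡ = refl ; A = members ; A-disjoint = members-disjoint ; A-nonempty = nonempty
        ; decomposed = λ j → subst (U._∈ Σ⊥ (t p j))
            (sym (cong₂ (λ s s′ → s ∷ s′ ∷ []) (u-even j) (u-odd j))) (Cuts.cut∈ j)
        })

  -- Common cut points and normal forms

  Large : ℚ → Condition → Set
  Large q p = ∀ i → q ◃ nor (t p i)

  -- e lists the ends of blocks of indices: the creatures of the j-th block lie
  -- below c (j + 1) and not below c (j - 1), its first one below c j and its
  -- last one above c j.
  record Interlaces (p : Condition) (c : ℕ → ℕ) : Set where
    field
      e      : ℕ → ℕ
      e-zero : e 0 ≡ 0
      e-<    : ∀ j → e j ℕ.< e (suc j)
      below  : ∀ j {i x} → i ℕ.≤ e j → x ∈ dom (t p i) → x ℕ.< c j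
      above  : ∀ j {i x} → e (suc j) ℕ.≤ suc i → x ∈ dom (t p i) → c j ℕ.≤ x

  module _ (p : Condition) where

    domBound : ℕ → ℕ
    domBound m = bound (concatMap (dom ∘ t p) (upTo (suc m)))

    <domBound : ∀ {m i x} → i ℕ.≤ m → x ∈ dom (t p i) → x ℕ.< domBound m
    <domBound i≤m x∈i =
      ∈⇒<bound (∈-concatMap⁺ (dom ∘ t p) (Any.map (λ { refl → x∈i }) (∈-upTo⁺ (s≤s i≤m))))

    private
      owner : ℕ → ℕ
      -- Points of the domain of `w p` have no owner; the default 0 does not affect a maximum.
      owner x = [ (λ _ → 0) , proj₁ ]′ (covering p x)

      owner-≡ : ∀ {i x} → x ∈ dom (t p i) → owner x ≡ i
      owner-≡ {i} {x} x∈i with covering p x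
      ... | inj₁ x∈w       = contradiction (x∈w , x∈i) (disjoint-w p i)
      ... | inj₂ (j , x∈j) = owner-unique p x∈j x∈i

    indexBound : ℕ → ℕ
    indexBound c = bound (map owner (upTo c))

    -- Each point below `c` belongs to at most one creature, so only finitely many creatures reach
    -- below `c`.
    <indexBound : ∀ {c i x} → x ∈ dom (t p i) → x ℕ.< c → i ℕ.< indexBound c
    <indexBound x∈i x<c =
      subst (ℕ._< _) (owner-≡ x∈i) (∈⇒<bound (∈-map⁺ owner (∈-upTo⁺ x<c)))

  module _ {m} (p : Fin m → Condition) where

    mutual
      -- A cut point must serve all `p k` at once, hence the `sup`, while each `p k` has its own
      -- block ends. The cut point passes the domains up to the current end; the next end passes
      -- every creature reaching below the cut point.
      interlacing : ℕ → ℕ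
      interlacing j = sup λ k → domBound (p k) (blockEnd k j)

      blockEnd : Fin m → ℕ → ℕ
      blockEnd k zero    = zero
      -- The extra `suc` keeps the creature with index `indexBound (p k) (interlacing j)`, which
      -- lies above the cut, inside block `j` as its last member.
      blockEnd k (suc j) = suc (indexBound (p k) (interlacing j))

    interlacing-interlaces : ∀ k → Interlaces (p k) interlacing
    interlacing-interlaces k = record
      { e      = blockEnd k
      ; e-zero = refl
      -- The creature at `blockEnd k j` has a point below the cut, so its index is below
      -- `indexBound`.
      ; e-<    = λ j → let x , x∈ = ∃∈dom (t (p k) (blockEnd k j)) in
                 ℕ.m<n⇒m<1+n (<indexBound (p k) x∈ (below j ℕ.≤-refl x∈))
      ; below  = below
      ; above  = λ j ≤i x∈i → ℕ.≮⇒≥ λ x<c → ℕ.<⇒≱ (<indexBound (p k) x∈i x<c) (ℕ.s≤s⁻¹ ≤i)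
      }
      where
      below : ∀ j {i x} → i ℕ.≤ blockEnd k j → x ∈ dom (t (p k) i) → x ℕ.< interlacing j
      below j i≤e x∈i = ℕ.<-≤-trans (<domBound (p k) i≤e x∈i) (≤-sup _ k)

  Stretch : (ℕ → ℕ) → ℕ → ℕ → Set
  Stretch c zero    x = x ℕ.< c 0
  Stretch c (suc j) x = c j ℕ.≤ x × x ℕ.< c (suc j)

  module _ (gluing : SemiGluing 𝒯) (cutting : CuttingProperty 𝒯)
           (p : Condition) {c : ℕ → ℕ} (interlaces : Interlaces p c)
           {q : ℚ} (1◃ : ∀ x → q ℚ.+ 1ℚ ℚ.+ 1ℚ ◃ x → 1ℚ ◃ x)
           (large : Large (q ℚ.+ 1ℚ ℚ.+ 1ℚ ℚ.+ 1ℚ) p) where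

    private
      open Interlaces interlaces

      blocks : Grouping
      blocks = intervals e e-zero e-<

      last : ℕ → ℕ
      last j = ℕ.pred (e (suc j))

      suc-last : ∀ j → suc (last j) ≡ e (suc j)
      suc-last j = ℕ.suc-pred (e (suc j)) {{ℕ.>-nonZero (ℕ.≤-<-trans z≤n (e-< j))}}

      -- The first and last creatures of a block lie on opposite sides of the cut point and witness
      -- that both pieces have finite norm.
      cuts : ∀ p₁ → (∀ j → t p₁ j U.∈ Σ (map (t p) (Grouping.members blocks j))) →
             Large (q ℚ.+ 1ℚ ℚ.+ 1ℚ) p₁ → ∀ j → Cut (t p₁ j) (c j)
      cuts p₁ ∈Σ₁ large₁ j = cutAt cutting (t p₁ j) (c j) (∈Σ₁ j) (1◃ (nor (t p₁ j)) (large₁ j))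
        (t p (e j)) (t p (last j))
        (∈-map⁺ (t p) (∈-interval⁺ e e-zero e-< ℕ.≤-refl (e-< j)))
        (∈-map⁺ (t p) (∈-interval⁺ e e-zero e-< (ℕ.<⇒≤pred (e-< j)) (ℕ.≤-reflexive (suc-last j))))
        (nor-finite p _) (nor-finite p _)
        (below j ℕ.≤-refl) (above j (ℕ.≤-reflexive (sym (suc-last j))))

    -- The domains are described by `c` and `w p` alone, so conditions sharing both acquire the same
    -- domains.
    normalForm : ∃ λ p′ → p ≤Q p′ × w p′ ≡ w p × Large q p′ ×
      (∀ j {x} → x ∈ dom (t p′ j) ⇔ (x ∉ FiniteFunction.dom (w p) × Stretch c j x))
    normalForm with glueAll gluing p blocks
    ... | p₁ , p⟶p₁ , w₁≡ , ∈Σ₁ , large₁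
        with cutAll p₁ c (cuts p₁ ∈Σ₁ (large₁ large))
    ... | p₂ , p₁⟶p₂ , w₂≡ , even≡ , odd≡ , large₂
        with glueAll gluing p₂ oddPairs
    ... | p₃ , p₂⟶p₃ , w₃≡ , ∈Σ₃ , large₃ =
      p₃ , p⟶p₁ ◅ p₁⟶p₂ ◅ p₂⟶p₃ ◅ ε , trans w₃≡ (trans w₂≡ w₁≡) , large₃ (large₂ (large₁ large)) ,
      λ j → mk⇔
        (λ x∈j → let i , x∈i , x∈stretch = stretch⁻ j x∈j in
                 (λ x∈w → disjoint-w p i (x∈w , x∈i)) , x∈stretch)
        (λ (x∉w , x∈stretch) →
          [ (λ x∈w → contradiction x∈w x∉w)
          , (λ (i , x∈i) → stretch⁺ j x∈i x∈stretch) ]′ (covering p _))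
      where
      module Cuts j = Cut (cuts p₁ ∈Σ₁ (large₁ large) j)

      InBlock : ℕ → ℕ → Set
      InBlock j x = ∃ λ i → (e j ℕ.≤ i × i ℕ.< e (suc j)) × x ∈ dom (t p i)

      block⁻ : ∀ j {x} → x ∈ dom (t p₁ j) → InBlock j x
      block⁻ j x∈ = let i , i∈ , x∈i = dom-grouped⁻ p blocks (∈Σ₁ j) x∈ in
        i , ∈-interval⁻ e e-zero e-< i∈ , x∈i

      block⁺ : ∀ j {x} → InBlock j x → x ∈ dom (t p₁ j)
      block⁺ j (i , (lo , hi) , x∈i) = dom-grouped⁺ p blocks (∈Σ₁ j) (∈-interval⁺ e e-zero e-< lo hi) x∈i

      lower⁻ : ∀ j {x} → x ∈ dom (t p₂ (double j)) → InBlock j x × x ℕ.< c j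
      lower⁻ j {x} x∈ = let x∈j , x<c = to (Cuts.lower-dom j) (subst (λ s → x ∈ dom s) (even≡ j) x∈) in
        block⁻ j x∈j , x<c

      lower⁺ : ∀ j {x} → InBlock j x → x ℕ.< c j → x ∈ dom (t p₂ (double j))
      lower⁺ j {x} x∈j x<c =
        subst (λ s → x ∈ dom s) (sym (even≡ j)) (from (Cuts.lower-dom j) (block⁺ j x∈j , x<c))

      upper⁻ : ∀ j {x} → x ∈ dom (t p₂ (suc (double j))) → InBlock j x × c j ℕ.≤ x
      upper⁻ j {x} x∈ = let x∈j , c≤x = to (Cuts.upper-dom j) (subst (λ s → x ∈ dom s) (odd≡ j) x∈) in
        block⁻ j x∈j , c≤x

      upper⁺ : ∀ j {x} → InBlock j x → c j ℕ.≤ x → x ∈ dom (t p₂ (suc (double j)))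
      upper⁺ j {x} x∈j c≤x =
        subst (λ s → x ∈ dom s) (sym (odd≡ j)) (from (Cuts.upper-dom j) (block⁺ j x∈j , c≤x))

      -- For a joined pair, one end of the stretch comes from the cut and the other from
      -- interlacing: block `j` stays below `c (suc j)`, and block `suc j` does not reach below
      -- `c j`.
      stretch⁻ : ∀ j {x} → x ∈ dom (t p₃ j) → ∃ λ i → x ∈ dom (t p i) × Stretch c j x
      stretch⁻ j x∈j with j | dom-grouped⁻ p₂ oddPairs (∈Σ₃ j) x∈j
      ... | zero  | _ , here refl , x∈ =
              let (i , _ , x∈i) , x<c = lower⁻ zero x∈ in i , x∈i , x<c
      ... | suc j | _ , here refl , x∈ =
              let (i , (_ , hi) , x∈i) , c≤x = upper⁻ j x∈ in
              i , x∈i , c≤x , below (suc j) (ℕ.<⇒≤ hi) x∈i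
      ... | suc j | _ , there (here refl) , x∈ =
              let (i , (lo , _) , x∈i) , x<c = lower⁻ (suc j) x∈ in
              i , x∈i , above j (ℕ.m≤n⇒m≤1+n lo) x∈i , x<c

      <e-suc : ∀ j {i x} → x ∈ dom (t p i) → x ℕ.< c j → i ℕ.< e (suc j)
      <e-suc j x∈i x<c = ℕ.≰⇒> λ e≤i → ℕ.<⇒≱ x<c (above j (ℕ.m≤n⇒m≤1+n e≤i) x∈i)

      -- Interlacing confines `i` to blocks `j` and `suc j`. Comparison with `e (suc j)` selects the
      -- upper piece of the one or the lower piece of the other.
      stretch⁺ : ∀ j {i x} → x ∈ dom (t p i) → Stretch c j x → x ∈ dom (t p₃ j)
      stretch⁺ zero    {i} x∈i x<c = dom-grouped⁺ p₂ oddPairs {j = zero} (∈Σ₃ zero) (here refl)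
        (lower⁺ zero (i , (subst (ℕ._≤ i) (sym e-zero) z≤n , <e-suc zero x∈i x<c) , x∈i) x<c)
      stretch⁺ (suc j) {i} x∈i (c≤x , x<c) with i ℕ.<? e (suc j)
      ... | yes i<e = dom-grouped⁺ p₂ oddPairs {j = suc j} (∈Σ₃ (suc j)) (here refl)
              (upper⁺ j (i , (ℕ.≮⇒≥ (λ i<ej → ℕ.<⇒≱ (below j (ℕ.<⇒≤ i<ej) x∈i) c≤x) , i<e) , x∈i) c≤x)
      ... | no  i≮e = dom-grouped⁺ p₂ oddPairs {j = suc j} (∈Σ₃ (suc j)) (there (here refl))
              (lower⁺ (suc j) (i , (ℕ.≮⇒≥ i≮e , <e-suc (suc j) x∈i x<c) , x∈i) x<c)

  -- Linking conditions with the same domains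

  link : Linked 𝒯 → ∀ n (u : Fin (suc n) → Creature) → (∀ k l → dom (u k) ∼[ set ] dom (u l)) →
         (∀ k → 1ℚ ⊕ n ◃ nor (u k)) →
         ∃ λ s → (∀ k → s U.∈ Σ [ u k ]) × (∀ {q} → (∀ k → q ⊕ n ◃ nor (u k)) → q ◃ nor s)
  link linked zero    u _    _     = u zero , (λ { zero → Comp.self (u zero) }) , λ large → large zero
  link linked (suc n) u dom≡ large
    -- The tail is linked first and the result then linked with the head, at a cost of 1. The bound
    -- by `1ℚ ⊕ suc n` keeps both norms above 1; the estimate for every `q` will give divergence.
    with link linked n (u ∘ suc) (λ k l → dom≡ (suc k) (suc l))
           (λ k → ◃-⊕-pred n (nor (u (suc k))) (large (suc k)))
  ... | s , s∈ , s-large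
    with linked (u zero) s
           (◃⇒<⁺ (ℚ.<-irrefl refl) (◃-⊕ (suc n) (nor (u zero)) (large zero)))
           (◃⇒<⁺ (ℚ.<-irrefl refl) (s-large λ k → ◃-⊕-pred n (nor (u (suc k))) (large (suc k))))
           dom₀∼s
    where
    dom₀∼s : dom (u zero) ∼[ set ] dom s
    dom₀∼s = mk⇔
      (λ x∈ → Σ-⊆dom {t = s} (s∈ zero) (here refl) (to (dom≡ zero (suc zero)) x∈))
      (λ x∈s → case ∈-⋃dom⁻ {S = [ u (suc zero) ]} (to (Comp.dom-⋃ {t = s} (s∈ zero)) x∈s) of
        λ { (_ , here refl , x∈) → from (dom≡ zero (suc zero)) x∈ })
  ... | r , r∈u₀ , r∈s , r≥ =
    r , (λ { zero → r∈u₀ ; (suc k) → Σ-trans {u = s} r∈s (s∈ k) }) ,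
    λ {q} large → ◃-−1 (nor (u zero) ⊓⁺ nor s) r≥
      (◃-⊓⁺ (nor (u zero)) (nor s) (◃-⊕ n (nor (u zero)) (large zero)) (s-large (large ∘ suc)))

  linkAll : Linked 𝒯 → ∀ n (p : Fin (suc n) → Condition) → (∀ k l → w (p k) ≡ w (p l)) →
            (∀ k l j → dom (t (p k) j) ∼[ set ] dom (t (p l) j)) → (∀ k → Large (1ℚ ⊕ n) (p k)) →
            ∃ λ r → ∀ k → p k ≤Q r
  linkAll linked n p w≡ dom≡ large =
    r , λ k → ⟶-grouped (p k) singletons r (w≡ zero k) refl (λ j → u∈ j k) ◅ ε
    where
    linkedAt : ∀ j → _
    linkedAt j = link linked n (λ k → t (p k) j) (λ k l → dom≡ k l j) (λ k → large k j)
    u : ℕ → Creature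
    u = proj₁ ∘ linkedAt
    u∈ : ∀ j k → u j U.∈ Σ [ t (p k) j ]
    u∈ j = proj₁ (proj₂ (linkedAt j))
    u-diverges : Diverges u
    -- Linking loses at most `n`, so one waits until all of the finitely many conditions exceed
    -- `q ⊕ n`.
    u-diverges q = sup N , λ j N≤j → proj₂ (proj₂ (linkedAt j)) λ k →
      proj₂ (t-diverges (p k) (q ⊕ n)) j (ℕ.≤-trans (≤-sup N k) N≤j)
      where
      N : Fin (suc n) → ℕ
      N k = proj₁ (t-diverges (p k) (q ⊕ n))
    r : Condition
    r = grouped (p zero) singletons u (λ j → u∈ j zero) u-diverges

  -- Deciding finitely many creatures

  decideFirst : ∀ p → ∃ λ p′ → p ⟶ p′ × (∀ i → t p′ i ≡ t p (suc i))
  decideFirst p = p′ , decide decides , λ _ → refl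
    where
    open FiniteFunction (w p) using (values) renaming (dom to dʷ; dom-sorted to dʷ-sorted)
    d₀ = dom (t p 0)
    v₀ = proj₁ (SemiCreature.sval-nonempty (proj₁ (t p 0)))

    -- The old values take precedence, then an allowed assignment of the decided creature, then the
    -- default.
    h : ∀ i → H i
    h = override values (override v₀ pick)

    ∈?d : U.Decidable (_∈ dʷ ++ d₀)
    ∈?d x = mem? ℕ._≟_ x (dʷ ++ d₀)

    d : List ℕ
    -- Filtering an initial segment of ω, instead of merging lists, gives a sorted union.
    d = filter ∈?d (upTo (bound (dʷ ++ d₀)))

    d∼ : d ∼[ set ] dʷ ++ d₀
    d∼ = mk⇔ (λ x∈ → proj₂ (∈-filter⁻ ∈?d {xs = upTo (bound (dʷ ++ d₀))} x∈))
             (λ x∈ → ∈-filter⁺ ∈?d (∈-upTo⁺ (∈⇒<bound x∈)) x∈)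

    d-sorted : AllPairs ℕ._<_ d
    d-sorted = AllPairs.filter⁺ ∈?d (AllPairs.applyUpTo⁺₁ id _ λ i<j _ → i<j)

    p′ : Condition
    p′ = record
      { w          = record { dom = d ; dom-sorted = d-sorted ; values = All.universal h d }
      ; t          = t p ∘ suc
      ; covering   = λ n → case covering p n of λ
          { (inj₁ n∈w)           → inj₁ (from d∼ (∈-++⁺ˡ n∈w))
          ; (inj₂ (zero  , n∈))  → inj₁ (from d∼ (∈-++⁺ʳ dʷ n∈))
          ; (inj₂ (suc i , n∈))  → inj₂ (i , n∈) }
      ; disjoint-w = λ i (x∈d , x∈i) →
          [ (λ x∈w → disjoint-w p (suc i) (x∈w , x∈i))
          , (λ x∈₀ → disjoint-t p 0 (suc i) (λ ()) (x∈₀ , x∈i)) ]′ (∈-++⁻ dʷ (to d∼ x∈d))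
      ; disjoint-t = λ i j i≢j → disjoint-t p (suc i) (suc j) (i≢j ∘ ℕ.suc-injective)
      ; nor-finite = nor-finite p ∘ suc
      ; nor-limit  = λ M → let N , large = nor-limit p M in N , λ i N≤i → large (suc i) (ℕ.m≤n⇒m≤1+n N≤i)
      }

    decides : DecidesValue p p′
    decides = record
      { A       = [ 0 ]
      ; dom-w   = subst (λ d′ → d ∼[ set ] dʷ ++ d′) (sym (++-identityʳ d₀)) d∼
      ; extends = λ sub → trans (universal-↾ h dʷ sub) (universal-override dʷ-sorted values _)
      ; decided = λ { _ (here refl) sub → subst (sval (t p 0))
          (sym (trans (universal-↾ h d₀ sub)
               (trans (universal-override-disjoint values (override v₀ pick) (disjoint-w p 0))
                      (universal-override (dom-sorted (t p 0)) v₀ pick))))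
          (proj₂ (SemiCreature.sval-nonempty (proj₁ (t p 0)))) }
      ; kept    = λ { zero 0∉ → contradiction (here refl) 0∉ ; (suc i) _ → i , ≈ᶜ-refl {t p (suc i)} }
      ; only    = λ j → suc j , (λ { (here ()) }) , ≈ᶜ-refl {t p (suc j)}
      }

  decideInitial : ∀ N p → ∃ λ p′ → p ≤Q p′ × (∀ i → t p′ i ≡ t p (N + i))
  decideInitial zero    p = p , ε , λ _ → refl
  decideInitial (suc N) p =
    let p₁ , p⟶p₁ , t₁≡ = decideFirst p
        p₂ , p₁≤p₂ , t₂≡ = decideInitial N p₁
    in p₂ , p⟶p₁ ◅ p₁≤p₂ , λ i → trans (t₂≡ i) (t₁≡ (N + i))

  -- By the limit condition, all creatures of norm at most `q` occur in an initial segment, and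
  -- deciding it removes them.
  ∃-large : ∀ q p → ∃ λ p′ → p ≤Q p′ × Large q p′
  ∃-large q p =
    let N , large = t-diverges p q
        p′ , p≤p′ , t≡ = decideInitial N p
    in p′ , p≤p′ , λ i → subst (λ s → q ◃ nor s) (sym (t≡ i)) (large (N + i) (ℕ.m≤m+n N i))

  -- Upper bounds of conditions with the same finite function

  upperBound : Linked 𝒯 → SemiGluing 𝒯 → CuttingProperty 𝒯 →
    ∀ n (p : Fin (suc n) → Condition) → (∀ k l → w (p k) ≡ w (p l)) →
    (∀ k → Large ((1ℚ ⊕ n) ℚ.+ 1ℚ ℚ.+ 1ℚ ℚ.+ 1ℚ) (p k)) → ∃ λ r → ∀ k → p k ≤Q r
  upperBound linked gluing cutting n p w≡ large =
    let r , ≤r = linkAll linked n (proj₁ ∘ normal)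
                   (λ k l → trans (w′≡ k) (trans (w≡ k l) (sym (w′≡ l))))
                   (λ k l j → mk⇔ (dom⊆ k l j) (dom⊆ l k j))
                   (λ k → proj₁ (proj₂ (proj₂ (proj₂ (normal k)))))
    in r , λ k → proj₁ (proj₂ (normal k)) ◅◅ ≤r k
    where
    normal : ∀ k → _
    -- The cut points `interlacing p` come from the whole family and do not depend on `k`.
    normal k = normalForm gluing cutting (p k) (interlacing-interlaces p k)
      -- Here `q` is `1ℚ ⊕ n`, the bound that `link` requires after the three losses.
      (λ x → ◃-⊕ n x ∘ ◃-pred x ∘ ◃-pred x) (large k)
    w′≡ : ∀ k → w (proj₁ (normal k)) ≡ w (p k)
    w′≡ k = proj₁ (proj₂ (proj₂ (normal k)))
    dom⊆ : ∀ k l j → dom (t (proj₁ (normal k)) j) ⊆ dom (t (proj₁ (normal l)) j)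
    dom⊆ k l j {x} x∈ =
      let dom⇔ = λ k → proj₂ (proj₂ (proj₂ (proj₂ (normal k)))) j {x}
          x∉w , x∈stretch = to (dom⇔ k) x∈
      in from (dom⇔ l) (subst (λ w → x ∉ FiniteFunction.dom w) (w≡ k l) x∉w , x∈stretch)

-- The partition by least codes

theorem2p4 : (em : ∀ {a} → ExcludedMiddle a) →
    ∀ {ℓ : Level} (H : ℕ → Set) →
    (∀ i → H i ↣ ℕ) → (∀ i → ∃₂ λ (x y : H i) → x ≢ y) →
    (𝒯 : SemiCreatingTriple H ℓ) →
    Linked 𝒯 → SemiGluing 𝒯 → CuttingProperty 𝒯 →
    σ-*-Linked (ℚ⁺∞ 𝒯)
theorem2p4 em H code two 𝒯 linked gluing cutting n =
  (λ i p → class p ≡ i) ,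
  record { respects = λ {_} {p} {q} p≈q p∈i → trans (sym (class-cong p q p≈q)) p∈i
         ; covers   = λ p → class p , refl
         ; disjoint = λ p∈i p∈j → trans (sym p∈i) p∈j } ,
  λ i p p∈i →
    -- Representatives of conditions in one class have equal codes, hence the same finite function;
    -- their upper bound also bounds the original conditions.
    let r , ≤r = upperBound 𝒯 pick linked gluing cutting n (proj₁ ∘ rep ∘ p)
          (λ k l → encodeʷ-injective code _ _
            (trans (code-rep (p k)) (trans (p∈i k) (sym (trans (code-rep (p l)) (p∈i l))))))
          (λ k → proj₁ (proj₂ (proj₂ (rep (p k)))))
    in r , λ k → proj₁ (proj₂ (rep (p k))) ◅◅ ≤r k
  where
  open Forcing 𝒯
  open Condition

  pick : ∀ i → H i
  pick i = proj₁ (two i)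

  B : ℚ
  B = (1ℚ ⊕ n) ℚ.+ 1ℚ ℚ.+ 1ℚ ℚ.+ 1ℚ

  Reaches : Condition → ℕ → Set _
  Reaches p m = ∃ λ p′ → p ≤Q p′ × Large 𝒯 pick B p′ × encodeʷ code (w p′) ≡ m

  -- The least code is invariant under ≈, unlike the code of a chosen p′.
  leastReached : ∀ p → ∃ λ m → Reaches p m × (∀ m′ → Reaches p m′ → m ℕ.≤ m′)
  leastReached p = let p′ , p≤p′ , large = ∃-large 𝒯 pick B p in
    least em (Reaches p) (encodeʷ code (w p′) , p′ , p≤p′ , large , refl)

  class : Condition → ℕ
  class = proj₁ ∘ leastReached

  rep : ∀ p → Reaches p (class p)
  rep p = proj₁ (proj₂ (leastReached p))

  code-rep : ∀ p → encodeʷ code (w (proj₁ (rep p))) ≡ class p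
  code-rep p = proj₂ (proj₂ (proj₂ (rep p)))

  -- A weaker condition reaches every code that a stronger one reaches. Used in both directions,
  -- this makes classes invariant under `≈`.
  class-mono : ∀ p q → q ≤Q p → class q ℕ.≤ class p
  class-mono p q q≤p = let p′ , p≤p′ , rest = rep p in
    proj₂ (proj₂ (leastReached q)) (class p) (p′ , q≤p ◅◅ p≤p′ , rest)

  class-cong : ∀ p q → p ≈ q → class p ≡ class q
  class-cong p q p≈q = ℕ.≤-antisym
    (class-mono q p (≈⇒⟶ p≈q ◅ ε))
    (class-mono p q (≈⇒⟶ (Preorder.Eq.sym forcing p≈q) ◅ ε))
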